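{- Every coloring game with weights in $\{ -\infty,0,1\}\cup(-\mathbb{N})$ converges to a $2$-stable partition in $O(n^2)$ steps (i.e. every sequence of $2$-deviations has length $O(n^2)$), where $n$ is the number of players. This upper bound is tight: there exist such games admitting sequences of $\Theta(n^2)$ deviations.
   Context: A coloring game $G=(V,w)$ has a finite set $V$ of $n$ players and symmetric weights $w_{uv}=w_{vu}$; $-\infty$ means enemies and $-\mathbb{N}$ denotes the negative integers. For a partition $P$ of $V$ with $X(u)$ the group of $u$, $f_u(P)=\sum_{v\in X(u)\setminus\{u\}} w_{uv}$. A $k$-deviation from $P$ is a set $S$ of at most $k$ players and a (possibly empty) group $X$ of $P$ such that moving all players of $S$ into $X$ strictly increases the utility of every member of $S$; $P$ is $k$-stable if no $k$-deviation exists. The dynamics starts from the all-singletons partition and applies arbitrary $k$-deviations while one exists. -}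

module Defs where

open import Data.Nat as ℕ using (ℕ; zero; suc; _≤_; _*_; _+_)
open import Data.Integer as ℤ using (ℤ; +_; -[1+_])
open import Data.Fin as Fin using (Fin)
open import Data.Fin.Subset using (Subset; _∈_; ∣_∣)
open import Data.Bool using (Bool; true; false; if_then_else_; _∧_; not)
open import Data.List using (List; foldr; map)
open import Data.List.Base using (allFin)
open import Data.Vec using (lookup)
open import Relation.Nullary using (does)
open import Relation.Binary.PropositionalEquality using (_≡_)

data ℤ∞ : Set where
  -∞  : ℤ∞
  fin : ℤ → ℤ∞

infixl 6 _+∞_
_+∞_ : ℤ∞ → ℤ∞ → ℤ∞
-∞    +∞ _     = -∞
fin _ +∞ -∞    = -∞
fin a +∞ fin b = fin (a ℤ.+ b)

infix 4 _<∞_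
data _<∞_ : ℤ∞ → ℤ∞ → Set where
  -∞<fin  : ∀ {b} → -∞ <∞ fin b
  fin<fin : ∀ {a b} → a ℤ.< b → fin a <∞ fin b

data Allowed : ℤ∞ → Set where
  w-∞   : Allowed -∞
  w0    : Allowed (fin (+ 0))
  w1    : Allowed (fin (+ 1))
  wneg  : ∀ k → Allowed (fin -[1+ k ])

record Game (n : ℕ) : Set where
  field
    w   : Fin n → Fin n → ℤ∞
    sym : ∀ u v → w u v ≡ w v u

-- A partition is represented by a labelling of players; groups = label classes.
Coloring : ℕ → Set
Coloring n = Fin n → ℕ

singletons : ∀ {n} → Coloring n
singletons u = Fin.toℕ u

utility : ∀ {n} → Game n → Coloring n → Fin n → ℤ∞
utility {n} G c u =
  foldr _+∞_ (fin (+ 0))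
    (map (λ v → if not (does (v Fin.≟ u)) ∧ does (c v ℕ.≟ c u)
                then Game.w G u v else fin (+ 0))
         (allFin n))

-- move all players of S into the group with label ℓ
-- (if no player carries ℓ, this is the empty group)
move : ∀ {n} → Coloring n → Subset n → ℕ → Coloring n
move c S ℓ u = if lookup S u then ℓ else c u

record IsDeviation {n} (G : Game n) (k : ℕ) (c : Coloring n)
                   (S : Subset n) (ℓ : ℕ) : Set where
  field
    nonempty : 1 ≤ ∣ S ∣
    small    : ∣ S ∣ ≤ k
    improves : ∀ u → u ∈ S → utility G c u <∞ utility G (move c S ℓ) u

data Run {n} (G : Game n) (k : ℕ) : ℕ → Coloring n → Set where
  start : Run G k 0 singletons
  step  : ∀ {L c} (S : Subset n) (ℓ : ℕ) →
          Run G k L c → IsDeviation G k c S ℓ → Run G k (suc L) (move c S ℓ)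

AllowedGame : ∀ {n} → Game n → Set
AllowedGame {n} G = ∀ (u v : Fin n) → Allowed (Game.w G u v)

module Submission where

-- The potential
-- Ψ(P) = Σ_u Σ_v [u, v share a group] w_uv is at most n² because weights are
-- at most 1, and it is 0 on the singletons.  Along a run no two enemies ever
-- share a group (a mover next to an enemy would have utility -∞), and each
-- 2-deviation raises Ψ by at least 2: by an inclusion–exclusion over the
-- pairs meeting the moving set S, the change of Ψ is twice the movers'
-- total gain (≥ |S|) minus the change inside S (≤ |S|² − |S|).
--
-- With m walkers, m
-- A-anchors and m B-anchors, walker i has i friends among the A-anchors and
-- m − i among the B-anchors, and all walkers are mutual friends.  After the
-- anchors have formed two groups, in phase r + 1 the walkers r + 1, …,
-- m − r − 2 successively join side B and then m − r − 1, …, r + 1 leave it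
-- again, each move raising the mover's utility from m − 1 to m.  Phases
-- q, …, 1 with m = 4q give 2q² single-player deviations.

open import Defs
open import Data.Nat as ℕ using (ℕ)
open import Data.Bool using (Bool)
open import Relation.Binary.PropositionalEquality using (_≡_; refl)

cong₃ : ∀ {A B C D : Set} (f : A → B → C → D) {a a′ b b′ c c′} →
        a ≡ a′ → b ≡ b′ → c ≡ c′ → f a b c ≡ f a′ b′ c′
cong₃ f refl refl refl = refl

module IntegerSums where
  open import Data.Nat as ℕ using (zero; suc)
  open import Data.Integer using (ℤ; +_; _+_; _*_; _-_; -_; _≤_)
  import Data.Integer.Properties as ℤP
  open import Data.Integer.Tactic.RingSolver using (solve-∀)
  open import Data.Fin as Fin using (Fin; zero; suc)
  open import Data.Bool using (if_then_else_)
  open import Relation.Nullary using (does; yes; no)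
  open import Relation.Binary.PropositionalEquality
  open import Algebra.Properties.Semiring.Sum ℤP.+-*-semiring public
    using (sum; sum-syntax; ∑-distrib-+; ∑-comm; *-distribˡ-sum; sum-cong-≗)

  ∑-neg : ∀ {n} (f : Fin n → ℤ) → ∑[ i < n ] (- f i) ≡ - sum f
  ∑-neg {zero}  f = refl
  ∑-neg {suc n} f = trans (cong (_+_ (- f zero)) (∑-neg (λ i → f (suc i))))
                          (sym (ℤP.neg-distrib-+ (f zero) (sum (λ i → f (suc i)))))

  ∑-distrib-− : ∀ {n} (f g : Fin n → ℤ) → ∑[ i < n ] (f i - g i) ≡ sum f - sum g
  ∑-distrib-− f g = trans (∑-distrib-+ f (λ i → - g i)) (cong (_+_ (sum f)) (∑-neg g))

  ∑-mono-≤ : ∀ {n} {f g : Fin n → ℤ} → (∀ i → f i ≤ g i) → sum f ≤ sum g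
  ∑-mono-≤ {zero}  f≤g = ℤP.≤-refl
  ∑-mono-≤ {suc n} f≤g = ℤP.+-mono-≤ (f≤g zero) (∑-mono-≤ (λ i → f≤g (suc i)))

  ∑-const : ∀ n k → ∑[ i < n ] k ≡ + n * k
  ∑-const zero    k = sym (ℤP.*-zeroˡ k)
  ∑-const (suc n) k = trans (cong (_+_ k) (∑-const n k)) (lemma k (+ n))
    where lemma : ∀ k n → k + n * k ≡ (+ 1 + n) * k
          lemma = solve-∀

  ∑-zero : ∀ {n} {f : Fin n → ℤ} → (∀ i → f i ≡ + 0) → sum f ≡ + 0
  ∑-zero {n} f≡0 = trans (sum-cong-≗ f≡0) (trans (∑-const n (+ 0)) (ℤP.*-zeroʳ (+ n)))

  δ : ∀ {n} → Fin n → Fin n → ℤ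
  δ u v = if does (v Fin.≟ u) then + 1 else + 0

  ∑-δ : ∀ {n} (u : Fin n) (f : Fin n → ℤ) → ∑[ v < n ] (δ u v * f v) ≡ f u
  ∑-δ {suc n} zero f = begin
      + 1 * f zero + ∑[ v < n ] (+ 0 * f (suc v))
    ≡⟨ cong (_+_ (+ 1 * f zero)) (trans (sum-cong-≗ (λ v → ℤP.*-zeroˡ (f (suc v)))) (∑-const n (+ 0))) ⟩
      + 1 * f zero + + n * + 0
    ≡⟨ lemma (f zero) (+ n) ⟩
      f zero ∎
    where open ≡-Reasoning
          lemma : ∀ a n → + 1 * a + n * + 0 ≡ a
          lemma = solve-∀
  ∑-δ {suc n} (suc u) f = trans (ℤP.+-identityˡ _)
    (trans (sum-cong-≗ shift) (∑-δ u (λ v → f (suc v))))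
    where
    shift : ∀ v → δ (suc u) (suc v) * f (suc v) ≡ δ u v * f (suc v)
    shift v with v Fin.≟ u
    ... | yes _ = refl
    ... | no  _ = refl

module Utilities {n : ℕ} (G : Game n) where
  open import Data.Nat as ℕ using (zero; suc)
  open import Data.Integer using (ℤ; +_)
  open import Data.Fin as Fin using (Fin; zero; suc)
  open import Data.Bool using (Bool; true; false; if_then_else_; _∧_; not)
  open import Data.List using (List; foldr; map)
  open import Data.List.Base using (tabulate)
  import Data.Vec.Functional as Vector
  open import Relation.Nullary using (does; yes; no; ¬_)
  open import Relation.Nullary.Decidable using (dec-true; dec-false)
  open import Relation.Binary.Definitions using (DecidableEquality)
  open import Data.Fin.Properties using (toℕ-injective)
  open import Data.Empty using (⊥-elim)
  open import Relation.Binary.PropositionalEquality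
  open IntegerSums using (sum)
  open Game G using (w)

  together : Coloring n → Fin n → Fin n → Bool
  together c u v = not (does (v Fin.≟ u)) ∧ does (c v ℕ.≟ c u)

  contribution : Coloring n → Fin n → Fin n → ℤ∞
  contribution c u v = if together c u v then w u v else fin (+ 0)

  Σ∞ : ∀ {k} → (Fin k → ℤ∞) → ℤ∞
  Σ∞ = Vector.foldr _+∞_ (fin (+ 0))

  foldr-tabulate : ∀ {k} {A : Set} (h : A → ℤ∞) (f : Fin k → A) →
    foldr _+∞_ (fin (+ 0)) (map h (tabulate f)) ≡ Σ∞ (λ i → h (f i))
  foldr-tabulate {zero}  h f = refl
  foldr-tabulate {suc k} h f = cong (h (f zero) +∞_) (foldr-tabulate h (λ i → f (suc i)))

  utility-as-Σ∞ : ∀ c u → utility G c u ≡ Σ∞ (contribution c u)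
  utility-as-Σ∞ c u = foldr-tabulate (contribution c u) (λ v → v)

  Σ∞-fin : ∀ {k} (g : Fin k → ℤ∞) (t : Fin k → ℤ) → (∀ i → g i ≡ fin (t i)) → Σ∞ g ≡ fin (sum t)
  Σ∞-fin {zero}  g t g≡t = refl
  Σ∞-fin {suc k} g t g≡t
    rewrite g≡t zero | Σ∞-fin (λ i → g (suc i)) (λ i → t (suc i)) (λ i → g≡t (suc i)) = refl

  Σ∞-absorb : ∀ {k} (g : Fin k → ℤ∞) i → g i ≡ -∞ → Σ∞ g ≡ -∞
  Σ∞-absorb {suc k} g zero    gi≡-∞ rewrite gi≡-∞ = refl
  Σ∞-absorb {suc k} g (suc i) gi≡-∞
    rewrite Σ∞-absorb (λ j → g (suc j)) i gi≡-∞ = absorbʳ (g zero)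
    where absorbʳ : ∀ a → a +∞ -∞ ≡ -∞
          absorbʳ -∞      = refl
          absorbʳ (fin _) = refl

  finitePart : ℤ∞ → ℤ
  finitePart -∞      = + 0
  finitePart (fin z) = z

  share : Coloring n → Fin n → Fin n → ℤ
  share c u v = if together c u v then finitePart (w u v) else + 0

  NoEnemiesTogether : Coloring n → Set
  NoEnemiesTogether c = ∀ u v → together c u v ≡ true → ¬ (w u v ≡ -∞)

  utility-finite : ∀ c → NoEnemiesTogether c → ∀ u → utility G c u ≡ fin (sum (share c u))
  utility-finite c safe u = trans (utility-as-Σ∞ c u) (Σ∞-fin (contribution c u) (share c u) finite)
    where
    finite : ∀ v → contribution c u v ≡ fin (share c u v)
    finite v with together c u v in tog | w u v in enemy
    ... | false | _      = refl
    ... | true  | fin _  = refl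
    ... | true  | -∞     = ⊥-elim (safe u v tog enemy)

  utility-enemy : ∀ c u v → together c u v ≡ true → w u v ≡ -∞ → utility G c u ≡ -∞
  utility-enemy c u v tog enemy = trans (utility-as-Σ∞ c u)
    (Σ∞-absorb (contribution c u) v (cong₂ (λ b x → if b then x else fin (+ 0)) tog enemy))

  together-sym : ∀ c u v → together c u v ≡ together c v u
  together-sym c u v = cong₂ (λ a b → not a ∧ b) (does-sym Fin._≟_ v u) (does-sym ℕ._≟_ (c v) (c u))
    where
    does-sym : ∀ {A : Set} (_≟_ : DecidableEquality A) x y → does (x ≟ y) ≡ does (y ≟ x)
    does-sym _≟_ x y with x ≟ y | y ≟ x
    ... | yes _   | yes _   = refl
    ... | no  _   | no  _   = refl
    ... | yes x≡y | no  y≢x = ⊥-elim (y≢x (sym x≡y))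
    ... | no  x≢y | yes y≡x = ⊥-elim (x≢y (sym y≡x))

  together-self : ∀ c u → together c u u ≡ false
  together-self c u = cong (λ a → not a ∧ does (c u ℕ.≟ c u)) (dec-true (u Fin.≟ u) refl)

  -- No utility lies below -∞, so no deviation can create a -∞ utility.
  nothing<-∞ : ∀ {a} → ¬ (a <∞ -∞)
  nothing<-∞ ()

  together-singletons : ∀ u v → together singletons u v ≡ false
  together-singletons u v with v Fin.≟ u
  ... | yes _   = refl
  ... | no  v≢u = dec-false (Fin.toℕ v ℕ.≟ Fin.toℕ u) (λ eq → v≢u (toℕ-injective eq))

module SubsetSums where
  open import Data.Nat as ℕ using (zero; suc)
  open import Data.Integer using (ℤ; +_; _+_; _*_; _-_; _≤_)
  import Data.Integer.Properties as ℤP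
  open import Data.Integer.Tactic.RingSolver using (solve-∀)
  open import Data.Fin using (Fin)
  open import Data.Fin.Subset using (Subset; ∣_∣)
  open import Data.Bool using (Bool; true; false; if_then_else_)
  open import Data.Vec using ([]; _∷_; lookup)
  open import Relation.Binary.PropositionalEquality
  open IntegerSums

  indicator : Bool → ℤ
  indicator b = if b then + 1 else + 0

  ι : ∀ {n} → Subset n → Fin n → ℤ
  ι S u = indicator (lookup S u)

  ∑ι≡∣S∣ : ∀ {n} (S : Subset n) → sum (ι S) ≡ + ∣ S ∣
  ∑ι≡∣S∣ {zero}  []          = refl
  ∑ι≡∣S∣ {suc n} (true  ∷ S) = cong (_+_ (+ 1)) (∑ι≡∣S∣ S)
  ∑ι≡∣S∣ {suc n} (false ∷ S) = cong (_+_ (+ 0)) (∑ι≡∣S∣ S)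

  ι-idem : ∀ {n} (S : Subset n) u → ι S u * ι S u ≡ ι S u
  ι-idem S u with lookup S u
  ... | true  = refl
  ... | false = refl

  module InclusionExclusion {n} (S : Subset n) (D : Fin n → Fin n → ℤ)
    (D-sym : ∀ u v → D u v ≡ D v u)
    (D-off : ∀ u v → lookup S u ≡ false → lookup S v ≡ false → D u v ≡ + 0) where

    X Z : ℤ
    X = ∑[ u < n ] (ι S u * ∑[ v < n ] D u v)
    Z = ∑[ u < n ] ∑[ v < n ] (ι S u * ι S v * D u v)

    pointwise : ∀ u v → D u v ≡ ι S u * D u v + ι S v * D u v - ι S u * ι S v * D u v
    pointwise u v with lookup S u in su | lookup S v in sv
    ... | true  | true  = lemma (D u v)
      where lemma : ∀ x → x ≡ + 1 * x + + 1 * x - + 1 * + 1 * x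
            lemma = solve-∀
    ... | true  | false = lemma (D u v)
      where lemma : ∀ x → x ≡ + 1 * x + + 0 * x - + 1 * + 0 * x
            lemma = solve-∀
    ... | false | true  = lemma (D u v)
      where lemma : ∀ x → x ≡ + 0 * x + + 1 * x - + 0 * + 1 * x
            lemma = solve-∀
    ... | false | false rewrite D-off u v su sv = refl

    swapped : ∑[ u < n ] ∑[ v < n ] (ι S v * D u v) ≡ X
    swapped = begin
        ∑[ u < n ] ∑[ v < n ] (ι S v * D u v)
      ≡⟨ ∑-comm (λ u v → ι S v * D u v) ⟩
        ∑[ v < n ] ∑[ u < n ] (ι S v * D u v)
      ≡⟨ sum-cong-≗ (λ v → trans (sum-cong-≗ (λ u → cong (ι S v *_) (D-sym u v)))
                                 (sym (*-distribˡ-sum (ι S v) (D v)))) ⟩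
        X ∎
      where open ≡-Reasoning

    inclusion-exclusion : ∑[ u < n ] ∑[ v < n ] D u v ≡ X + X - Z
    inclusion-exclusion = begin
        ∑[ u < n ] ∑[ v < n ] D u v
      ≡⟨ sum-cong-≗ (λ u → trans (sum-cong-≗ (pointwise u))
           (trans (∑-distrib-− (λ v → ι S u * D u v + ι S v * D u v) (λ v → ι S u * ι S v * D u v))
                  (cong (_- ∑[ v < n ] (ι S u * ι S v * D u v))
                        (∑-distrib-+ (λ v → ι S u * D u v) (λ v → ι S v * D u v))))) ⟩
        ∑[ u < n ] (∑[ v < n ] (ι S u * D u v) + ∑[ v < n ] (ι S v * D u v)
                    - ∑[ v < n ] (ι S u * ι S v * D u v))
      ≡⟨ trans (∑-distrib-− (λ u → ∑[ v < n ] (ι S u * D u v) + ∑[ v < n ] (ι S v * D u v))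
                             (λ u → ∑[ v < n ] (ι S u * ι S v * D u v)))
               (cong (_- Z) (∑-distrib-+ (λ u → ∑[ v < n ] (ι S u * D u v))
                                         (λ u → ∑[ v < n ] (ι S v * D u v)))) ⟩
        ∑[ u < n ] ∑[ v < n ] (ι S u * D u v) + ∑[ u < n ] ∑[ v < n ] (ι S v * D u v) - Z
      ≡⟨ cong₂ (λ a b → a + b - Z) (sum-cong-≗ (λ u → sym (*-distribˡ-sum (ι S u) (D u)))) swapped ⟩
        X + X - Z ∎
      where open ≡-Reasoning

  ∑∑-off-diagonal : ∀ {n} (S : Subset n) →
    ∑[ u < n ] ∑[ v < n ] (ι S u * ι S v * (+ 1 - δ u v)) ≡ + ∣ S ∣ * + ∣ S ∣ - + ∣ S ∣
  ∑∑-off-diagonal {n} S = begin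
      ∑[ u < n ] ∑[ v < n ] (ι S u * ι S v * (+ 1 - δ u v))
    ≡⟨ sum-cong-≗ (λ u → trans (sum-cong-≗ (λ v → expand (ι S u) (ι S v) (δ u v)))
                               (∑-distrib-− (λ v → ι S u * ι S v) (λ v → ι S u * (δ u v * ι S v)))) ⟩
      ∑[ u < n ] (∑[ v < n ] (ι S u * ι S v) - ∑[ v < n ] (ι S u * (δ u v * ι S v)))
    ≡⟨ ∑-distrib-− (λ u → ∑[ v < n ] (ι S u * ι S v)) (λ u → ∑[ v < n ] (ι S u * (δ u v * ι S v))) ⟩
      ∑[ u < n ] ∑[ v < n ] (ι S u * ι S v) - ∑[ u < n ] ∑[ v < n ] (ι S u * (δ u v * ι S v))
    ≡⟨ cong₂ _-_ square diagonal ⟩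
      k * k - k ∎
    where
    open ≡-Reasoning
    k = + ∣ S ∣
    expand : ∀ x y d → x * y * (+ 1 - d) ≡ x * y - x * (d * y)
    expand = solve-∀
    square : ∑[ u < n ] ∑[ v < n ] (ι S u * ι S v) ≡ k * k
    square = begin
        ∑[ u < n ] ∑[ v < n ] (ι S u * ι S v)
      ≡⟨ sum-cong-≗ (λ u → trans (sym (*-distribˡ-sum (ι S u) (ι S))) (ℤP.*-comm (ι S u) _)) ⟩
        ∑[ u < n ] (sum (ι S) * ι S u)
      ≡⟨ sym (*-distribˡ-sum (sum (ι S)) (ι S)) ⟩
        sum (ι S) * sum (ι S)
      ≡⟨ cong₂ _*_ (∑ι≡∣S∣ S) (∑ι≡∣S∣ S) ⟩
        k * k ∎
    diagonal : ∑[ u < n ] ∑[ v < n ] (ι S u * (δ u v * ι S v)) ≡ k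
    diagonal = trans (sum-cong-≗ (λ u → trans (sym (*-distribˡ-sum (ι S u) (λ v → δ u v * ι S v)))
                                       (trans (cong (ι S u *_) (∑-δ u (ι S))) (ι-idem S u))))
                     (∑ι≡∣S∣ S)

module Potential {n : ℕ} (G : Game n) (allowed : AllowedGame G) where
  open import Data.Nat as ℕ using (suc)
  import Data.Nat.Properties as ℕP
  open import Data.Integer as ℤ using (ℤ; +_; _+_; _*_; _-_; -_; _≤_; +≤+; -≤+)
  import Data.Integer.Properties as ℤP
  open import Data.Integer.Tactic.RingSolver using (solve-∀)
  open import Data.Fin as Fin using (Fin)
  open import Data.Fin.Subset using (Subset; ∣_∣)
  open import Data.Bool using (true; false; if_then_else_; _∧_; not)
  open import Data.Vec using (lookup)
  open import Data.Vec.Properties using (lookup⇒[]=)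
  open import Data.Product using (_×_; _,_; proj₂)
  open import Data.Empty using (⊥; ⊥-elim)
  open import Relation.Nullary using (Dec; does; yes; no; ¬_)
  open import Relation.Nullary.Decidable using (dec-true; dec-false)
  open import Relation.Binary.PropositionalEquality
  open IntegerSums
  open SubsetSums
  open Utilities G
  open Game G using (w)

  Ψ : Coloring n → ℤ
  Ψ c = ∑[ u < n ] sum (share c u)

  finitePart≤1 : ∀ {x} → Allowed x → finitePart x ≤ + 1
  finitePart≤1 w-∞      = +≤+ ℕ.z≤n
  finitePart≤1 w0       = +≤+ ℕ.z≤n
  finitePart≤1 w1       = ℤP.≤-refl
  finitePart≤1 (wneg k) = -≤+

  share≤1 : ∀ c u v → share c u v ≤ + 1
  share≤1 c u v with together c u v
  ... | true  = finitePart≤1 (allowed u v)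
  ... | false = +≤+ ℕ.z≤n

  share-sym : ∀ c u v → share c u v ≡ share c v u
  share-sym c u v = cong₂ (λ b x → if b then finitePart x else + 0) (together-sym c u v) (Game.sym G u v)

  -- Ψ has n² terms, each at most 1.
  Ψ≤n² : ∀ c → Ψ c ≤ + (n ℕ.* n)
  Ψ≤n² c = begin
      Ψ c
    ≤⟨ ∑-mono-≤ (λ u → ∑-mono-≤ (share≤1 c u)) ⟩
      ∑[ u < n ] ∑[ v < n ] (+ 1)
    ≡⟨ sum-cong-≗ {n} {λ _ → ∑[ v < n ] (+ 1)} {λ _ → + n}
                  (λ u → trans (∑-const n (+ 1)) (ℤP.*-identityʳ (+ n))) ⟩
      ∑[ u < n ] (+ n)
    ≡⟨ ∑-const n (+ n) ⟩
      + n * + n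
    ≡⟨ ℤP.pos-* n n ⟨
      + (n ℕ.* n) ∎
    where open ℤP.≤-Reasoning

  Ψ-singletons : Ψ singletons ≡ + 0
  Ψ-singletons = ∑-zero (λ u → ∑-zero (nobody u))
    where
    nobody : ∀ u v → share singletons u v ≡ + 0
    nobody u v = cong (λ b → if b then finitePart (w u v) else + 0) (together-singletons u v)

  module Deviation {c : Coloring n} {S : Subset n} {ℓ : ℕ}
    (safe : NoEnemiesTogether c) (dev : IsDeviation G 2 c S ℓ) where
    open IsDeviation dev

    c′ : Coloring n
    c′ = move c S ℓ

    improves′ : ∀ u → lookup S u ≡ true → utility G c u <∞ utility G c′ u
    improves′ u u∈S = improves u (lookup⇒[]= u S u∈S)

    stays : ∀ u → lookup S u ≡ false → c′ u ≡ c u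
    stays u u∉S = cong (λ b → if b then ℓ else c u) u∉S

    joins : ∀ u → lookup S u ≡ true → c′ u ≡ ℓ
    joins u u∈S = cong (λ b → if b then ℓ else c u) u∈S

    together-outside : ∀ u v → lookup S u ≡ false → lookup S v ≡ false → together c′ u v ≡ together c u v
    together-outside u v u∉S v∉S =
      cong₂ (λ a b → not (does (v Fin.≟ u)) ∧ does (a ℕ.≟ b)) (stays v v∉S) (stays u u∉S)

    -- A mover never ends up next to an enemy: its utility would become -∞.
    safe′ : NoEnemiesTogether c′
    safe′ u v tog enemy = by-membership (lookup S u) (lookup S v) refl refl
      where
      by-membership : ∀ a b → lookup S u ≡ a → lookup S v ≡ b → ⊥
      by-membership true  _    u∈S _   =
        nothing<-∞ (subst (utility G c u <∞_) (utility-enemy c′ u v tog enemy) (improves′ u u∈S))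
      by-membership false true _   v∈S =
        nothing<-∞ (subst (utility G c v <∞_)
          (utility-enemy c′ v u (trans (together-sym c′ v u) tog) (trans (Game.sym G v u) enemy))
          (improves′ v v∈S))
      by-membership false false u∉S v∉S = safe u v (trans (sym (together-outside u v u∉S v∉S)) tog) enemy

    Δ : Fin n → Fin n → ℤ
    Δ u v = share c′ u v - share c u v

    Δ-sym : ∀ u v → Δ u v ≡ Δ v u
    Δ-sym u v = cong₂ _-_ (share-sym c′ u v) (share-sym c u v)

    Δ-off : ∀ u v → lookup S u ≡ false → lookup S v ≡ false → Δ u v ≡ + 0
    Δ-off u v u∉S v∉S = trans
      (cong (λ b → (if b then finitePart (w u v) else + 0) - share c u v) (together-outside u v u∉S v∉S))
      (ℤP.+-inverseʳ (share c u v))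

    -- Two distinct movers end up together, so their mutual weight can only rise to w_uv ≤ 1.
    Δ-movers : ∀ u v → lookup S u ≡ true → lookup S v ≡ true → ¬ (v ≡ u) → Δ u v ≤ + 1
    Δ-movers u v u∈S v∈S v≢u = subst (λ x → x - share c u v ≤ + 1) (sym now-together) (bound (together c u v))
      where
      now-together : share c′ u v ≡ finitePart (w u v)
      now-together = cong (λ b → if b then finitePart (w u v) else + 0)
        (cong₂ (λ a b → not a ∧ b) (dec-false (v Fin.≟ u) v≢u)
               (dec-true (c′ v ℕ.≟ c′ u) (trans (joins v v∈S) (sym (joins u u∈S)))))
      bound : ∀ b → finitePart (w u v) - (if b then finitePart (w u v) else + 0) ≤ + 1
      bound true  = subst (_≤ + 1) (sym (ℤP.+-inverseʳ (finitePart (w u v)))) (+≤+ ℕ.z≤n)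
      bound false = subst (_≤ + 1) (sym (ℤP.+-identityʳ (finitePart (w u v)))) (finitePart≤1 (allowed u v))

    Δ-inside : ∀ u v → lookup S u ≡ true → lookup S v ≡ true → Δ u v ≤ + 1 - δ u v
    Δ-inside u v u∈S v∈S = by-diagonal (v Fin.≟ u)
      where
      by-diagonal : Dec (v ≡ u) → Δ u v ≤ + 1 - δ u v
      by-diagonal (yes refl) = subst₂ _≤_
        (sym (cong₂ (λ a b → (if a then finitePart (w u u) else + 0) - (if b then finitePart (w u u) else + 0))
                    (together-self c′ u) (together-self c u)))
        (sym (cong (λ b → + 1 - (if b then + 1 else + 0)) (dec-true (u Fin.≟ u) refl)))
        ℤP.≤-refl
      by-diagonal (no v≢u) = subst (Δ u v ≤_)
        (sym (cong (λ b → + 1 - (if b then + 1 else + 0)) (dec-false (v Fin.≟ u) v≢u)))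
        (Δ-movers u v u∈S v∈S v≢u)

    Δ-mover : ∀ u → lookup S u ≡ true → + 1 ≤ sum (Δ u)
    Δ-mover u u∈S with utility-finite c safe u | utility-finite c′ safe′ u | improves′ u u∈S
    ... | old | new | better with subst₂ _<∞_ old new better
    ...   | fin<fin lt = subst (+ 1 ≤_) (sym (∑-distrib-− (share c′ u) (share c u))) (gap lt)
      where
      gap : ∀ {x y} → x ℤ.< y → + 1 ≤ y - x
      gap {x} {y} x<y = subst (_≤ y - x) (cancel x) (ℤP.+-monoˡ-≤ (- x) (ℤP.i<j⇒suc[i]≤j x<y))
        where cancel : ∀ x → + 1 + x - x ≡ + 1
              cancel = solve-∀

    open InclusionExclusion S Δ Δ-sym Δ-off

    Ψ-difference : Ψ c′ - Ψ c ≡ ∑[ u < n ] ∑[ v < n ] Δ u v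
    Ψ-difference = sym (trans (sum-cong-≗ (λ u → ∑-distrib-− (share c′ u) (share c u)))
                              (∑-distrib-− (λ u → sum (share c′ u)) (λ u → sum (share c u))))

    movers-gain : + ∣ S ∣ ≤ X
    movers-gain = subst (_≤ X) (∑ι≡∣S∣ S) (∑-mono-≤ (λ u → weighted u (lookup S u) refl))
      where
      weighted : ∀ u b → lookup S u ≡ b → ι S u ≤ ι S u * sum (Δ u)
      weighted u true  u∈S = subst (λ i → i ≤ i * sum (Δ u)) (cong indicator (sym u∈S))
                               (subst (+ 1 ≤_) (sym (ℤP.*-identityˡ _)) (Δ-mover u u∈S))
      weighted u false u∉S = subst (λ i → i ≤ i * sum (Δ u)) (cong indicator (sym u∉S)) (+≤+ ℕ.z≤n)

    pairs-gain : Z ≤ + ∣ S ∣ * + ∣ S ∣ - + ∣ S ∣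
    pairs-gain = subst (Z ≤_) (∑∑-off-diagonal S)
      (∑-mono-≤ (λ u → ∑-mono-≤ (λ v → weighted u v (lookup S u) (lookup S v) refl refl)))
      where
      weighted : ∀ u v a b → lookup S u ≡ a → lookup S v ≡ b →
                 ι S u * ι S v * Δ u v ≤ ι S u * ι S v * (+ 1 - δ u v)
      weighted u v a b u∈S v∈S = subst₂ (λ i j → i * j * Δ u v ≤ i * j * (+ 1 - δ u v))
        (cong indicator (sym u∈S)) (cong indicator (sym v∈S)) (by-membership a b u∈S v∈S)
        where
        by-membership : ∀ a b → lookup S u ≡ a → lookup S v ≡ b →
                        indicator a * indicator b * Δ u v ≤ indicator a * indicator b * (+ 1 - δ u v)
        by-membership true  true  u∈S v∈S =
          subst₂ _≤_ (sym (ℤP.*-identityˡ _)) (sym (ℤP.*-identityˡ _)) (Δ-inside u v u∈S v∈S)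
        by-membership true  false _ _ =
          subst₂ _≤_ (sym (ℤP.*-zeroˡ (Δ u v))) (sym (ℤP.*-zeroˡ (+ 1 - δ u v))) ℤP.≤-refl
        by-membership false b     _ _ =
          subst₂ _≤_ (sym (ℤP.*-zeroˡ (indicator b * Δ u v)))
                     (sym (ℤP.*-zeroˡ (indicator b * (+ 1 - δ u v)))) ℤP.≤-refl

    small-gain : ∀ k → 1 ℕ.≤ k → k ℕ.≤ 2 → + 2 ≤ + k + + k - (+ k * + k - + k)
    small-gain 1 _ _ = ℤP.≤-refl
    small-gain 2 _ _ = ℤP.≤-refl
    small-gain (suc (suc (suc _))) _ (ℕ.s≤s (ℕ.s≤s ()))

    Ψ-grows : Ψ c + + 2 ≤ Ψ c′
    Ψ-grows = subst (_≤ Ψ c′) (ℤP.+-comm (+ 2) (Ψ c))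
      (subst (+ 2 + Ψ c ≤_) (cancel (Ψ c) (Ψ c′)) (ℤP.+-monoˡ-≤ (Ψ c) (begin
          + 2
        ≤⟨ small-gain ∣ S ∣ nonempty small ⟩
          k + k - (k * k - k)
        ≤⟨ ℤP.+-mono-≤ (ℤP.+-mono-≤ movers-gain movers-gain) (ℤP.neg-mono-≤ pairs-gain) ⟩
          X + X - Z
        ≡⟨ sym (trans Ψ-difference inclusion-exclusion) ⟩
          Ψ c′ - Ψ c ∎)))
      where
      open ℤP.≤-Reasoning
      k : ℤ
      k = + ∣ S ∣
      cancel : ∀ p q → q - p + p ≡ q
      cancel = solve-∀

  run-invariant : ∀ {L c} → Run G 2 L c → NoEnemiesTogether c × + (2 ℕ.* L) ≤ Ψ c
  run-invariant start = (λ u v tog → ⊥-elim (false≢true (trans (sym (together-singletons u v)) tog)))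
                      , subst (+ 0 ≤_) (sym Ψ-singletons) ℤP.≤-refl
    where false≢true : ¬ (false ≡ true)
          false≢true ()
  run-invariant (step {L} {c} S ℓ run dev) with run-invariant run
  ... | safe , 2L≤Ψ = Deviation.safe′ safe dev , (begin
      + (2 ℕ.* suc L)     ≡⟨ cong +_ (ℕP.*-suc 2 L) ⟩
      + 2 + + (2 ℕ.* L)   ≤⟨ ℤP.+-monoʳ-≤ (+ 2) 2L≤Ψ ⟩
      + 2 + Ψ c           ≡⟨ ℤP.+-comm (+ 2) (Ψ c) ⟩
      Ψ c + + 2           ≤⟨ Deviation.Ψ-grows safe dev ⟩
      Ψ (move c S ℓ)      ∎)
    where open ℤP.≤-Reasoning

  -- Hence 2L ≤ Ψ ≤ n², so a run has length at most n².
  run-length : ∀ {L c} → Run G 2 L c → L ℕ.≤ n ℕ.* n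
  run-length {L} {c} run = ℕP.≤-trans (ℕP.m≤m+n L (L ℕ.+ 0))
    (ℤP.drop‿+≤+ (ℤP.≤-trans (proj₂ (run-invariant run)) (Ψ≤n² c)))

module Comparisons where
  open import Data.Nat as ℕ using (suc; _≤_; _<_; _≤ᵇ_; _<ᵇ_; _≡ᵇ_)
  import Data.Nat.Properties as ℕP
  open import Data.Bool using (T; true; false)
  open import Relation.Nullary using (¬_)
  open import Relation.Nullary.Decidable using (dec-true; dec-false)
  open import Relation.Binary.PropositionalEquality using (_≡_; _≢_; refl; subst; sym; trans)
  open import Relation.Binary.Definitions using (tri<; tri≈; tri>)
  open import Data.Empty using (⊥-elim)

  ≤ᵇ-true : ∀ {a b} → a ≤ b → (a ≤ᵇ b) ≡ true
  ≤ᵇ-true {a} {b} = dec-true (a ℕ.≤? b)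
  ≤ᵇ-false : ∀ {a b} → ¬ a ≤ b → (a ≤ᵇ b) ≡ false
  ≤ᵇ-false {a} {b} = dec-false (a ℕ.≤? b)
  <ᵇ-true : ∀ {a b} → a < b → (a <ᵇ b) ≡ true
  <ᵇ-true {a} {b} = dec-true (a ℕ.<? b)
  <ᵇ-false : ∀ {a b} → ¬ a < b → (a <ᵇ b) ≡ false
  <ᵇ-false {a} {b} = dec-false (a ℕ.<? b)
  ≡ᵇ-true : ∀ {a b} → a ≡ b → (a ≡ᵇ b) ≡ true
  ≡ᵇ-true {a} {b} = dec-true (a ℕ.≟ b)
  ≡ᵇ-false : ∀ {a b} → a ≢ b → (a ≡ᵇ b) ≡ false
  ≡ᵇ-false {a} {b} = dec-false (a ℕ.≟ b)

  <ᵇ⇒< : ∀ {a b} → (a <ᵇ b) ≡ true → a < b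
  <ᵇ⇒< {a} {b} a<b = ℕP.<ᵇ⇒< a b (subst T (sym a<b) _)

  <ᵇ-suc : ∀ {j a} → j ≢ a → (j <ᵇ suc a) ≡ (j <ᵇ a)
  <ᵇ-suc {j} {a} j≢a with ℕP.<-cmp j a
  ... | tri< j<a _ _ = trans (<ᵇ-true (ℕP.m<n⇒m<1+n j<a)) (sym (<ᵇ-true j<a))
  ... | tri≈ _ j≡a _ = ⊥-elim (j≢a j≡a)
  ... | tri> _ _ j>a = trans (<ᵇ-false (λ j<1+a → ℕP.<-irrefl refl (ℕP.<-≤-trans j>a (ℕP.≤-pred j<1+a))))
                             (sym (<ᵇ-false (ℕP.<-asym j>a)))

  ≤ᵇ-suc : ∀ {j a} → j ≢ a → (a ≤ᵇ j) ≡ (suc a ≤ᵇ j)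
  ≤ᵇ-suc {j} {a} j≢a with ℕP.<-cmp j a
  ... | tri< j<a _ _ = trans (≤ᵇ-false (ℕP.<⇒≱ j<a)) (sym (≤ᵇ-false (λ a<j → ℕP.<-asym j<a a<j)))
  ... | tri≈ _ j≡a _ = ⊥-elim (j≢a j≡a)
  ... | tri> _ _ j>a = trans (≤ᵇ-true (ℕP.<⇒≤ j>a)) (sym (≤ᵇ-true j>a))

  ≮⇒≥ : ∀ {a b} → (a <ᵇ b) ≡ false → b ≤ a
  ≮⇒≥ {a} {b} a≮b = ℕP.≮⇒≥ (λ a<b → subst T a≮b (ℕP.<⇒<ᵇ a<b))

module Counting where
  open import Data.Nat using (zero; suc; _+_; _∸_; _≤_; _<_; _≤ᵇ_; _<ᵇ_; z≤n; s≤s)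
  import Data.Nat.Properties as ℕP
  open import Data.Nat.Tactic.RingSolver using (solve-∀)
  open import Data.Bool using (Bool; if_then_else_)
  open import Relation.Binary.PropositionalEquality
  open import Function using (_⟨_⟩_)
  open Comparisons

  ΣN : ℕ → (ℕ → ℕ) → ℕ
  ΣN zero    f = 0
  ΣN (suc n) f = f 0 + ΣN n (λ k → f (suc k))

  bit : Bool → ℕ
  bit b = if b then 1 else 0

  ΣN-cong : ∀ n {f g : ℕ → ℕ} → (∀ k → k < n → f k ≡ g k) → ΣN n f ≡ ΣN n g
  ΣN-cong zero    f≡g = refl
  ΣN-cong (suc n) f≡g = cong₂ _+_ (f≡g 0 (s≤s z≤n)) (ΣN-cong n (λ k k<n → f≡g (suc k) (s≤s k<n)))

  ΣN-split : ∀ a b (f : ℕ → ℕ) → ΣN (a + b) f ≡ ΣN a f + ΣN b (λ k → f (a + k))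
  ΣN-split zero    b f = refl
  ΣN-split (suc a) b f = trans (cong (f 0 +_) (ΣN-split a b (λ k → f (suc k)))) (sym (ℕP.+-assoc (f 0) _ _))

  ΣN-+ : ∀ n (f g : ℕ → ℕ) → ΣN n (λ k → f k + g k) ≡ ΣN n f + ΣN n g
  ΣN-+ zero    f g = refl
  ΣN-+ (suc n) f g = trans (cong (f 0 + g 0 +_) (ΣN-+ n (λ k → f (suc k)) (λ k → g (suc k))))
                           (swap (f 0) (g 0) _ _)
    where swap : ∀ a b c e → a + b + (c + e) ≡ a + c + (b + e)
          swap = solve-∀

  ΣN-zero : ∀ n (f : ℕ → ℕ) → (∀ k → k < n → f k ≡ 0) → ΣN n f ≡ 0
  ΣN-zero n f f≡0 = ΣN-cong n f≡0 ⟨ trans ⟩ ΣN-zeros n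
    where ΣN-zeros : ∀ n → ΣN n (λ _ → 0) ≡ 0
          ΣN-zeros zero    = refl
          ΣN-zeros (suc n) = ΣN-zeros n

  ΣN-ones : ∀ n (f : ℕ → ℕ) → (∀ k → k < n → f k ≡ 1) → ΣN n f ≡ n
  ΣN-ones n f f≡1 = ΣN-cong n f≡1 ⟨ trans ⟩ ΣN-units n
    where ΣN-units : ∀ n → ΣN n (λ _ → 1) ≡ n
          ΣN-units zero    = refl
          ΣN-units (suc n) = cong suc (ΣN-units n)

  ΣN-term≤ : ∀ n (f : ℕ → ℕ) k → k < n → f k ≤ ΣN n f
  ΣN-term≤ (suc n) f zero    _         = ℕP.m≤m+n (f 0) _
  ΣN-term≤ (suc n) f (suc k) (s≤s k<n) = ℕP.≤-trans (ΣN-term≤ n (λ j → f (suc j)) k k<n) (ℕP.m≤n+m _ (f 0))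

  ΣN-update : ∀ n (f f′ : ℕ → ℕ) j → j < n → (∀ k → k < n → k ≢ j → f′ k ≡ f k) →
              ΣN n f′ + f j ≡ ΣN n f + f′ j
  ΣN-update (suc n) f f′ zero _ f′≡f = begin
      f′ 0 + ΣN n (λ k → f′ (suc k)) + f 0
    ≡⟨ cong (λ x → f′ 0 + x + f 0) (ΣN-cong n (λ k k<n → f′≡f (suc k) (s≤s k<n) (λ ()))) ⟩
      f′ 0 + ΣN n (λ k → f (suc k)) + f 0
    ≡⟨ swap (f′ 0) (ΣN n (λ k → f (suc k))) (f 0) ⟩
      f 0 + ΣN n (λ k → f (suc k)) + f′ 0 ∎
    where open ≡-Reasoning
          swap : ∀ a b c → a + b + c ≡ c + b + a
          swap = solve-∀
  ΣN-update (suc n) f f′ (suc j) (s≤s j<n) f′≡f = begin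
      f′ 0 + ΣN n (λ k → f′ (suc k)) + f (suc j)
    ≡⟨ ℕP.+-assoc (f′ 0) _ _ ⟩
      f′ 0 + (ΣN n (λ k → f′ (suc k)) + f (suc j))
    ≡⟨ cong₂ _+_ (f′≡f 0 (s≤s z≤n) (λ ()))
                 (ΣN-update n (λ k → f (suc k)) (λ k → f′ (suc k)) j j<n
                   (λ k k<n k≢j → f′≡f (suc k) (s≤s k<n) (λ eq → k≢j (ℕP.suc-injective eq)))) ⟩
      f 0 + (ΣN n (λ k → f (suc k)) + f′ (suc j))
    ≡⟨ ℕP.+-assoc (f 0) _ _ ⟨
      f 0 + ΣN n (λ k → f (suc k)) + f′ (suc j) ∎
    where open ≡-Reasoning

  count-below : ∀ m i → i ≤ m → ΣN m (λ j → bit (j <ᵇ i)) ≡ i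
  count-below m i i≤m = begin
      ΣN m (λ j → bit (j <ᵇ i))
    ≡⟨ cong (λ z → ΣN z (λ j → bit (j <ᵇ i))) (ℕP.m+[n∸m]≡n i≤m) ⟨
      ΣN (i + (m ∸ i)) (λ j → bit (j <ᵇ i))
    ≡⟨ ΣN-split i (m ∸ i) _ ⟩
      ΣN i (λ j → bit (j <ᵇ i)) + ΣN (m ∸ i) (λ j → bit (i + j <ᵇ i))
    ≡⟨ cong₂ _+_ (ΣN-ones i _ (λ j j<i → cong bit (<ᵇ-true j<i)))
                 (ΣN-zero (m ∸ i) _ (λ j _ → cong bit (<ᵇ-false (ℕP.m+n≮m i j)))) ⟩
      i + 0
    ≡⟨ ℕP.+-identityʳ i ⟩
      i ∎
    where open ≡-Reasoning

  count-from : ∀ m i → i ≤ m → ΣN m (λ j → bit (i ≤ᵇ j)) ≡ m ∸ i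
  count-from m i i≤m = begin
      ΣN m (λ j → bit (i ≤ᵇ j))
    ≡⟨ cong (λ z → ΣN z (λ j → bit (i ≤ᵇ j))) (ℕP.m+[n∸m]≡n i≤m) ⟨
      ΣN (i + (m ∸ i)) (λ j → bit (i ≤ᵇ j))
    ≡⟨ ΣN-split i (m ∸ i) _ ⟩
      ΣN i (λ j → bit (i ≤ᵇ j)) + ΣN (m ∸ i) (λ j → bit (i ≤ᵇ i + j))
    ≡⟨ cong₂ _+_ (ΣN-zero i _ (λ j j<i → cong bit (≤ᵇ-false (ℕP.<⇒≱ j<i))))
                 (ΣN-ones (m ∸ i) _ (λ j _ → cong bit (≤ᵇ-true (ℕP.m≤m+n i j)))) ⟩
      m ∸ i ∎
    where open ≡-Reasoning

-- Games in which two players are either friends (weight 1) or indifferent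
-- (weight 0), for a symmetric friendship relation on the indices 0 … n−1.
-- Partitions are described by labellings s : ℕ → ℕ of the indices.
module FriendshipGame (n : ℕ) (friends : ℕ → ℕ → Bool)
                      (friends-sym : ∀ p k → friends p k ≡ friends k p) where
  open import Data.Nat as ℕ using (zero; suc; _+_; _≤_; _<_; _≡ᵇ_; z≤n; s≤s)
  import Data.Nat.Properties as ℕP
  open import Data.Integer as ℤ using (+_; +<+)
  open import Data.Fin as Fin using (Fin; zero; suc; toℕ; fromℕ<)
  import Data.Fin.Properties as FinP
  open import Data.Fin.Subset using (⁅_⁆)
  import Data.Fin.Subset.Properties as SubsetP
  open import Data.Bool using (Bool; true; false; if_then_else_; _∧_; not)
  import Data.Bool.Properties as BoolP
  open import Data.Vec using (lookup)
  import Data.Vec.Properties as VecP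
  open import Data.Product using (Σ; _×_; _,_)
  open import Relation.Nullary using (does; yes; no)
  open import Data.Empty using (⊥-elim)
  open import Relation.Binary.PropositionalEquality
  open Comparisons
  open Counting
  open IntegerSums using (sum)

  weight : Bool → ℤ∞
  weight b = fin (+ bit b)

  game : Game n
  game = record { w = λ u v → weight (friends (toℕ u) (toℕ v))
                ; sym = λ u v → cong weight (friends-sym (toℕ u) (toℕ v)) }

  allowed : AllowedGame game
  allowed u v with friends (toℕ u) (toℕ v)
  ... | true  = w1
  ... | false = w0

  buddy : (ℕ → ℕ) → ℕ → ℕ → ℕ
  buddy s p k = if not (k ≡ᵇ p) ∧ (s k ≡ᵇ s p) then bit (friends p k) else 0

  U : (ℕ → ℕ) → ℕ → ℕ
  U s p = ΣN n (buddy s p)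

  utility≡U : ∀ c s → (∀ v → c v ≡ s (toℕ v)) → ∀ u → utility game c u ≡ fin (+ U s (toℕ u))
  utility≡U c s c≡s u = trans (utility-finite c (λ _ _ _ ()) u)
                        (cong fin (trans (sum-cong-≗ as-buddy) (sum-toℕ n (buddy s (toℕ u)))))
    where
    open Utilities game
    open IntegerSums using (sum-cong-≗)
    does-toℕ : ∀ (v : Fin n) → does (v Fin.≟ u) ≡ (toℕ v ≡ᵇ toℕ u)
    does-toℕ v with v Fin.≟ u
    ... | yes v≡u = sym (≡ᵇ-true (cong toℕ v≡u))
    ... | no  v≢u = sym (≡ᵇ-false (λ eq → v≢u (FinP.toℕ-injective eq)))
    finite : ∀ b f → (if b then finitePart (weight f) else + 0) ≡ + (if b then bit f else 0)
    finite true  f = refl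
    finite false f = refl
    as-buddy : ∀ v → share c u v ≡ + buddy s (toℕ u) (toℕ v)
    as-buddy v = trans (cong₃ (λ a x y → if not a ∧ (x ≡ᵇ y)
                                   then finitePart (weight (friends (toℕ u) (toℕ v))) else + 0)
                              (does-toℕ v) (c≡s v) (c≡s u))
                       (finite _ _)
    sum-toℕ : ∀ k (f : ℕ → ℕ) → sum (λ (v : Fin k) → + f (toℕ v)) ≡ + ΣN k f
    sum-toℕ zero    f = refl
    sum-toℕ (suc k) f = cong (ℤ._+_ (+ f 0)) (sum-toℕ k (λ j → f (suc j)))

  Reach : ℕ → (ℕ → ℕ) → Set
  Reach K s = Σ ℕ λ L → K ≤ L × Σ (Coloring n) λ c → Run game 2 L c × (∀ v → c v ≡ s (toℕ v))

  reach-start : Reach 0 (λ k → k)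
  reach-start = 0 , z≤n , singletons , start , λ v → refl

  reach-≗ : ∀ {K s s′} → (∀ k → k < n → s k ≡ s′ k) → Reach K s → Reach K s′
  reach-≗ s≗s′ (L , K≤L , c , run , c≡s) =
    L , K≤L , c , run , λ v → trans (c≡s v) (s≗s′ (toℕ v) (FinP.toℕ<n v))

  reach-weaken : ∀ {K K′ s} → K′ ≤ K → Reach K s → Reach K′ s
  reach-weaken K′≤K (L , K≤L , rest) = L , ℕP.≤-trans K′≤K K≤L , rest

  reach-move : ∀ {K s s′} p → p < n → (∀ k → k < n → k ≢ p → s′ k ≡ s k) → U s p < U s′ p →
               Reach K s → Reach (suc K) s′
  reach-move {K} {s} {s′} p p<n s′≡s better (L , K≤L , c , run , c≡s) =
    suc L , s≤s K≤L , move c ⁅ u ⁆ (s′ p) , step ⁅ u ⁆ (s′ p) run deviation , moved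
    where
    u : Fin n
    u = fromℕ< p<n
    toℕu : toℕ u ≡ p
    toℕu = FinP.toℕ-fromℕ< p<n
    moved : ∀ v → move c ⁅ u ⁆ (s′ p) v ≡ s′ (toℕ v)
    moved v with v Fin.≟ u
    ... | yes refl = trans (cong (λ b → if b then s′ p else c u) (VecP.[]=⇒lookup (SubsetP.x∈⁅x⁆ u)))
                           (cong s′ (sym toℕu))
    ... | no  v≢u  = trans (cong (λ b → if b then s′ p else c v) (outside (lookup ⁅ u ⁆ v) refl))
                           (trans (c≡s v) (sym (s′≡s (toℕ v) (FinP.toℕ<n v)
                             (λ eq → v≢u (FinP.toℕ-injective (trans eq (sym toℕu)))))))
      where
      outside : ∀ b → lookup ⁅ u ⁆ v ≡ b → lookup ⁅ u ⁆ v ≡ false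
      outside true  v∈ = ⊥-elim (v≢u (SubsetP.x∈⁅y⁆⇒x≡y u (VecP.lookup⇒[]= v ⁅ u ⁆ v∈)))
      outside false v∉ = v∉
    gain : utility game c u <∞ utility game (move c ⁅ u ⁆ (s′ p)) u
    gain = subst₂ _<∞_
      (sym (trans (utility≡U c s c≡s u) (cong (λ x → fin (+ U s x)) toℕu)))
      (sym (trans (utility≡U _ s′ moved u) (cong (λ x → fin (+ U s′ x)) toℕu)))
      (fin<fin (+<+ better))
    deviation : IsDeviation game 2 c ⁅ u ⁆ (s′ p)
    deviation = record
      { nonempty = ℕP.≤-reflexive (sym (SubsetP.∣⁅x⁆∣≡1 u))
      ; small    = ℕP.≤-trans (ℕP.≤-reflexive (SubsetP.∣⁅x⁆∣≡1 u)) (s≤s z≤n)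
      ; improves = λ v v∈ → subst (λ x → utility game c x <∞ utility game (move c ⁅ u ⁆ (s′ p)) x)
                                  (sym (SubsetP.x∈⁅y⁆⇒x≡y u v∈)) gain }

  U-alone : ∀ s p → (∀ k → k ≢ p → s k ≢ s p) → U s p ≡ 0
  U-alone s p alone = ΣN-zero n (buddy s p) (λ k _ → nobody k)
    where
    nobody : ∀ k → buddy s p k ≡ 0
    nobody k with k ℕ.≟ p
    ... | yes refl = cong (λ a → if not a ∧ (s k ≡ᵇ s k) then bit (friends k k) else 0) (≡ᵇ-true {k} refl)
    ... | no  k≢p  = trans (cong (λ b → if not (k ≡ᵇ p) ∧ b then bit (friends p k) else 0)
                                 (≡ᵇ-false (alone k k≢p)))
                           (cong (λ b → if b then bit (friends p k) else 0) (BoolP.∧-zeroʳ (not (k ≡ᵇ p))))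

  U-friend : ∀ s p f → f < n → f ≢ p → s f ≡ s p → friends p f ≡ true → 1 ≤ U s p
  U-friend s p f f<n f≢p same friendly = subst (_≤ U s p) one (ΣN-term≤ n (buddy s p) f f<n)
    where
    one : buddy s p f ≡ 1
    one = trans (cong₂ (λ a b → if not a ∧ b then bit (friends p f) else 0) (≡ᵇ-false f≢p) (≡ᵇ-true same))
                (cong bit friendly)

  join-friend : ∀ {K s s′} p f → p < n → f < n → f ≢ p → friends p f ≡ true →
                (∀ k → k ≢ p → s k ≢ s p) → s′ f ≡ s′ p → (∀ k → k < n → k ≢ p → s′ k ≡ s k) →
                Reach K s → Reach (suc K) s′
  join-friend {s = s} {s′} p f p<n f<n f≢p friendly alone joined s′≡s =
    reach-move p p<n s′≡s (subst (_< U s′ p) (sym (U-alone s p alone)) (U-friend s′ p f f<n f≢p joined friendly))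

-- Indices are
-- grouped into four blocks: walkers i, anchors A_j = m + j and
-- B_j = m + (m + j) (all i, j < m), and idlers m + (m + (m + j)) (j < d).  Once all A-anchors share a group and all B-anchors another,
-- walker i counts i anchor friends on side A and m − i on side B.
module Construction (m d : ℕ) (m≥1 : 1 ℕ.≤ m) where
  open import Data.Nat as ℕ using (zero; suc; _+_; _*_; _∸_; _≤_; _<_; _≤ᵇ_; _<ᵇ_; _≡ᵇ_; z≤n; s≤s)
  import Data.Nat.Properties as ℕP
  open import Data.Bool using (Bool; true; false; if_then_else_; _∧_; _∨_; not)
  import Data.Bool.Properties as BoolP
  open import Data.Product using (Σ; _×_; _,_)
  open import Data.Sum using (_⊎_; inj₁; inj₂)
  open import Relation.Nullary using (¬_; yes; no)
  open import Relation.Binary.PropositionalEquality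
  open import Function using (_⟨_⟩_)
  open import Data.Nat.Tactic.RingSolver using (solve-∀)
  open Comparisons
  open Counting

  n : ℕ
  n = m + (m + (m + d))

  -- Sides: false = A, true = B.
  data Block : Set where
    walker : ℕ → Block
    anchor : Bool → ℕ → Block
    idler  : ℕ → Block

  index : Block → ℕ
  index (walker i)       = i
  index (anchor false j) = m + j
  index (anchor true  j) = m + (m + j)
  index (idler j)        = m + (m + (m + j))

  block : ℕ → Block
  block k = if k <ᵇ m then walker k
            else if k <ᵇ m + m then anchor false (k ∸ m)
            else if k <ᵇ m + (m + m) then anchor true (k ∸ (m + m))
            else idler (k ∸ (m + (m + m)))

  Valid : Block → Set
  Valid (walker i)   = i < m
  Valid (anchor _ j) = j < m
  Valid (idler j)    = j < d

  block-index : ∀ k → index (block k) ≡ k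
  block-index k with k <ᵇ m in k<m
  ... | true = refl
  ... | false with k <ᵇ m + m in k<2m
  ...   | true = ℕP.m+[n∸m]≡n (≮⇒≥ {k} {m} k<m)
  ...   | false with k <ᵇ m + (m + m) in k<3m
  ...     | true  = trans (sym (ℕP.+-assoc m m _)) (ℕP.m+[n∸m]≡n (≮⇒≥ {k} {m + m} k<2m))
  ...     | false = trans (cong (m +_) (sym (ℕP.+-assoc m m _)))
                        (trans (sym (ℕP.+-assoc m (m + m) _)) (ℕP.m+[n∸m]≡n (≮⇒≥ {k} {m + (m + m)} k<3m)))

  block-valid : ∀ k → k < n → Valid (block k)
  block-valid k k<n with k <ᵇ m in k<m
  ... | true = <ᵇ⇒< k<m
  ... | false with k <ᵇ m + m in k<2m
  ...   | true  = ℕP.+-cancelˡ-< m _ m (subst (_< m + m) (sym (ℕP.m+[n∸m]≡n (≮⇒≥ {k} {m} k<m))) (<ᵇ⇒< k<2m))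
  ...   | false with k <ᵇ m + (m + m) in k<3m
  ...     | true  = ℕP.+-cancelˡ-< (m + m) _ m
                      (subst (_< m + m + m) (sym (ℕP.m+[n∸m]≡n (≮⇒≥ {k} {m + m} k<2m)))
                             (subst (k <_) (sym (ℕP.+-assoc m m m)) (<ᵇ⇒< k<3m)))
  ...     | false = ℕP.+-cancelˡ-< (m + (m + m)) _ d
                      (subst (_< m + (m + m) + d) (sym (ℕP.m+[n∸m]≡n (≮⇒≥ {k} {m + (m + m)} k<3m)))
                             (subst (k <_) (sym (trans (ℕP.+-assoc m (m + m) d) (cong (m +_) (ℕP.+-assoc m m d)))) k<n))

  index<n : ∀ b → Valid b → index b < n
  index<n (walker i)       i<m = ℕP.<-≤-trans i<m (ℕP.m≤m+n m _)
  index<n (anchor false j) j<m = ℕP.+-monoʳ-< m (ℕP.<-≤-trans j<m (ℕP.m≤m+n m _))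
  index<n (anchor true j)  j<m = ℕP.+-monoʳ-< m (ℕP.+-monoʳ-< m (ℕP.<-≤-trans j<m (ℕP.m≤m+n m d)))
  index<n (idler j)        j<d = ℕP.+-monoʳ-< m (ℕP.+-monoʳ-< m (ℕP.+-monoʳ-< m j<d))

  index-block : ∀ b → Valid b → block (index b) ≡ b
  index-block (walker i) i<m rewrite <ᵇ-true i<m = refl
  index-block (anchor false j) j<m
    rewrite <ᵇ-false (ℕP.m+n≮m m j) | <ᵇ-true (ℕP.+-monoʳ-< m j<m) | ℕP.m+n∸m≡n m j = refl
  index-block (anchor true j) j<m
    rewrite <ᵇ-false (ℕP.m+n≮m m (m + j))
          | <ᵇ-false (λ lt → ℕP.m+n≮m m j (ℕP.+-cancelˡ-< m (m + j) m lt))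
          | <ᵇ-true (ℕP.+-monoʳ-< m (ℕP.+-monoʳ-< m j<m))
          | trans (cong (_∸ (m + m)) (sym (ℕP.+-assoc m m j))) (ℕP.m+n∸m≡n (m + m) j) = refl
  index-block (idler j) _
    rewrite <ᵇ-false (ℕP.m+n≮m m (m + (m + j)))
          | <ᵇ-false (λ lt → ℕP.m+n≮m m (m + j) (ℕP.+-cancelˡ-< m (m + (m + j)) m lt))
          | <ᵇ-false (λ lt → ℕP.m+n≮m m j (ℕP.+-cancelˡ-< m (m + j) m
                                              (ℕP.+-cancelˡ-< m (m + (m + j)) (m + m) lt)))
          | trans (cong (_∸ (m + (m + m))) (sym (trans (ℕP.+-assoc m (m + m) j) (cong (m +_) (ℕP.+-assoc m m j)))))
                  (ℕP.m+n∸m≡n (m + (m + m)) j) = refl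

  sameSide : Bool → Bool → Bool
  sameSide false false = true
  sameSide true  true  = true
  sameSide false true  = false
  sameSide true  false = false

  friendly : Block → Block → Bool
  friendly (walker _)       (walker _)       = true
  friendly (walker i)       (anchor false j) = j <ᵇ i
  friendly (walker i)       (anchor true  j) = i ≤ᵇ j
  friendly (anchor false j) (walker i)       = j <ᵇ i
  friendly (anchor true  j) (walker i)       = i ≤ᵇ j
  friendly (anchor a _)     (anchor b _)     = sameSide a b
  friendly (walker _)       (idler _)        = false
  friendly (anchor _ _)     (idler _)        = false
  friendly (idler _)        _                = false

  friendly-sym : ∀ b c → friendly b c ≡ friendly c b
  friendly-sym (walker _)       (walker _)       = refl
  friendly-sym (walker _)       (anchor false _) = refl
  friendly-sym (walker _)       (anchor true  _) = refl
  friendly-sym (walker _)       (idler _)        = refl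
  friendly-sym (anchor false _) (walker _)       = refl
  friendly-sym (anchor true  _) (walker _)       = refl
  friendly-sym (anchor false _) (anchor false _) = refl
  friendly-sym (anchor false _) (anchor true  _) = refl
  friendly-sym (anchor true  _) (anchor false _) = refl
  friendly-sym (anchor true  _) (anchor true  _) = refl
  friendly-sym (anchor false _) (idler _)        = refl
  friendly-sym (anchor true  _) (idler _)        = refl
  friendly-sym (idler _)        (walker _)       = refl
  friendly-sym (idler _)        (anchor false _) = refl
  friendly-sym (idler _)        (anchor true  _) = refl
  friendly-sym (idler _)        (idler _)        = refl

  open FriendshipGame n (λ p k → friendly (block p) (block k)) (λ p k → friendly-sym (block p) (block k)) public

  -- The two big groups are labelled by their first anchors A₀ and B₀.
  groupLabel : Bool → ℕ
  groupLabel g = index (anchor g 0)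

  -- A stage of the construction: the anchors j < joinedA (resp. j < joinedB)
  -- of side A (resp. B) and the walkers i ≥ firstWalker sit in the group of
  -- their side; every other player is still alone, labelled by its own index.
  record Stage : Set where
    constructor stage
    field
      joinedA joinedB firstWalker : ℕ
      side : ℕ → Bool
  open Stage

  joined : Stage → Bool → ℕ
  joined st false = joinedA st
  joined st true  = joinedB st

  place : Stage → Block → ℕ
  place st (walker i)   = if firstWalker st ≤ᵇ i then groupLabel (side st i) else index (walker i)
  place st (anchor g j) = if j <ᵇ joined st g then groupLabel g else index (anchor g j)
  place st (idler j)    = index (idler j)

  label : Stage → ℕ → ℕ
  label st k = place st (block k)

  settled : (ℕ → Bool) → Stage
  settled x = stage m m 0 x

  index-injective : ∀ b c → Valid b → Valid c → index b ≡ index c → b ≡ c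
  index-injective b c vb vc eq = trans (sym (index-block b vb)) (trans (cong block eq) (index-block c vc))

  label-at : ∀ st b → Valid b → label st (index b) ≡ place st b
  label-at st b vb = cong (place st) (index-block b vb)

  label-kinds : ∀ st k → label st k ≡ k ⊎ Σ Bool (λ g → label st k ≡ groupLabel g)
  label-kinds st k = subst (λ i → label st k ≡ i ⊎ Σ Bool (λ g → label st k ≡ groupLabel g))
                            (block-index k) (place-kinds (block k))
    where
    place-kinds : ∀ b → place st b ≡ index b ⊎ Σ Bool (λ g → place st b ≡ groupLabel g)
    place-kinds (walker i) with firstWalker st ≤ᵇ i
    ... | true  = inj₂ (side st i , refl)
    ... | false = inj₁ refl
    place-kinds (anchor g j) with j <ᵇ joined st g
    ... | true  = inj₂ (g , refl)
    ... | false = inj₁ refl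
    place-kinds (idler j) = inj₁ refl

  alone : ∀ st p → label st p ≡ p → (∀ g → p ≢ groupLabel g) → ∀ k → k ≢ p → label st k ≢ label st p
  alone st p own notGroup k k≢p same with label-kinds st k
  ... | inj₁ own-k       = k≢p (trans (sym own-k) (trans same own))
  ... | inj₂ (g , in-g)  = notGroup g (trans (sym own) (trans (sym same) in-g))

  label-agree : ∀ st st′ β → (∀ b → b ≢ β → place st′ b ≡ place st b) →
                ∀ k → k ≢ index β → label st′ k ≡ label st k
  label-agree st st′ β agree k k≢β = agree (block k) (λ eq → k≢β (trans (sym (block-index k)) (cong index eq)))

  initial : ∀ x k → k < n → label (stage 1 1 m x) k ≡ k
  initial x k k<n = trans (place-initial (block k) (block-valid k k<n)) (block-index k)
    where
    place-initial : ∀ b → Valid b → place (stage 1 1 m x) b ≡ index b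
    place-initial (walker i)           i<m rewrite ≤ᵇ-false (ℕP.<⇒≱ i<m) = refl
    place-initial (anchor false zero)    _ = refl
    place-initial (anchor true  zero)    _ = refl
    place-initial (anchor false (suc j)) _ = refl
    place-initial (anchor true  (suc j)) _ = refl
    place-initial (idler j)              _ = refl

  anchor-injective : ∀ {g h i j} → anchor g i ≡ anchor h j → i ≡ j
  anchor-injective refl = refl

  not-group : ∀ b → Valid b → (∀ g → b ≢ anchor g 0) → ∀ g → index b ≢ groupLabel g
  not-group b vb b≢ g eq = b≢ g (index-injective b (anchor g 0) vb m≥1 eq)

  -- Forming the big groups from the singletons: first the anchors of side A
  -- join A₀ one by one, then those of side B join B₀, and finally the
  -- walkers m−1, …, 0 join their side.  Each mover is alone and joins a friend.
  module Formation (x : ℕ → Bool) where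

    anchorStage : Bool → ℕ → Stage
    anchorStage false a = stage a 1 m x
    anchorStage true  b = stage m b m x

    joined-anchorStage : ∀ g a → joined (anchorStage g a) g ≡ a
    joined-anchorStage false a = refl
    joined-anchorStage true  a = refl

    anchor-joins : ∀ {K} g a → 1 ≤ a → a < m →
                   Reach K (label (anchorStage g a)) → Reach (suc K) (label (anchorStage g (suc a)))
    anchor-joins g a 1≤a a<m =
      join-friend (index (anchor g a)) (index (anchor g 0)) (index<n (anchor g a) a<m) (index<n (anchor g 0) m≥1)
        (λ eq → a≢0 (sym (anchor-injective (index-injective (anchor g 0) (anchor g a) m≥1 a<m eq))))
        (trans (cong₂ friendly (index-block (anchor g a) a<m) (index-block (anchor g 0) m≥1)) (same-side-friends g))
        (alone st p alone-before (not-group (anchor g a) a<m (λ h eq → a≢0 (anchor-injective eq))))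
        (trans (label-at st′ (anchor g 0) m≥1) (trans (joined-now 0 (s≤s z≤n))
               (sym (trans (label-at st′ (anchor g a) a<m) (joined-now a (ℕP.n<1+n a))))))
        (λ k _ k≢p → label-agree st st′ (anchor g a) unchanged k k≢p)
      where
      st st′ : Stage
      st  = anchorStage g a
      st′ = anchorStage g (suc a)
      p : ℕ
      p = index (anchor g a)
      a≢0 : a ≢ 0
      a≢0 refl = ℕP.<-irrefl refl 1≤a
      same-side-friends : ∀ g → friendly (anchor g a) (anchor g 0) ≡ true
      same-side-friends false = refl
      same-side-friends true  = refl
      alone-before : label st p ≡ p
      alone-before = trans (label-at st (anchor g a) a<m)
        (cong (λ b → if b then groupLabel g else p)
              (trans (cong (a <ᵇ_) (joined-anchorStage g a)) (<ᵇ-false {a} {a} (ℕP.<-irrefl refl))))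
      joined-now : ∀ j → j < suc a → place st′ (anchor g j) ≡ groupLabel g
      joined-now j j<1+a = cong (λ b → if b then groupLabel g else index (anchor g j))
                                (trans (cong (j <ᵇ_) (joined-anchorStage g (suc a))) (<ᵇ-true j<1+a))
      unchanged : ∀ b → b ≢ anchor g a → place st′ b ≡ place st b
      unchanged (walker i)   _ = anchors-only g
        where anchors-only : ∀ g → place (anchorStage g (suc a)) (walker i) ≡ place (anchorStage g a) (walker i)
              anchors-only false = refl
              anchors-only true  = refl
      unchanged (idler j)    _ = refl
      unchanged (anchor h j) b≢ = same-or-other g h b≢
        where
        same-or-other : ∀ g h → anchor h j ≢ anchor g a →
          place (anchorStage g (suc a)) (anchor h j) ≡ place (anchorStage g a) (anchor h j)
        same-or-other false false b≢ = cong (λ b → if b then groupLabel false else index (anchor false j))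
                                            (<ᵇ-suc (λ j≡a → b≢ (cong (anchor false) j≡a)))
        same-or-other true  true  b≢ = cong (λ b → if b then groupLabel true else index (anchor true j))
                                            (<ᵇ-suc (λ j≡a → b≢ (cong (anchor true) j≡a)))
        same-or-other false true  _  = refl
        same-or-other true  false _  = refl

    -- Walker w has a friend already sitting on its side: B_w on side B, A₀
    -- on side A, except walker 0 which has no A-anchor friend but has walker 1.
    walker-friend : ∀ w → w < m → 1 < m → x 1 ≡ false →
                    Σ Block λ b → Valid b × b ≢ walker w × friendly (walker w) b ≡ true ×
                                  place (stage m m w x) b ≡ groupLabel (x w)
    walker-friend w w<m 1<m x1≡A with x w
    ... | true  = anchor true w , w<m , (λ ()) , ≤ᵇ-true (ℕP.≤-refl {w}) ,
                  cong (λ b → if b then groupLabel true else index (anchor true w)) (<ᵇ-true w<m)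
    walker-friend (suc w) _ _ _ | false = anchor false 0 , m≥1 , (λ ()) , refl ,
                  cong (λ b → if b then groupLabel false else index (anchor false 0)) (<ᵇ-true m≥1)
    walker-friend zero    _ 1<m x1≡A | false = walker 1 , 1<m , (λ ()) , refl , cong groupLabel x1≡A

    walker-joins : ∀ {K} w → w < m → 1 < m → x 1 ≡ false →
                   Reach K (label (stage m m (suc w) x)) → Reach (suc K) (label (stage m m w x))
    walker-joins w w<m 1<m x1≡A with walker-friend w w<m 1<m x1≡A
    ... | b , vb , b≢w , friendly-b , b-joined =
      join-friend w (index b) (index<n (walker w) w<m) (index<n b vb)
        (λ eq → b≢w (index-injective b (walker w) vb w<m eq))
        (trans (cong₂ friendly (index-block (walker w) w<m) (index-block b vb)) friendly-b)
        (alone st w alone-before (not-group (walker w) w<m (λ g ())))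
        (trans (label-at st′ b vb) (trans b-joined (sym joined-now)))
        (λ k _ k≢w → label-agree st st′ (walker w) unchanged k k≢w)
      where
      st st′ : Stage
      st  = stage m m (suc w) x
      st′ = stage m m w x
      alone-before : label st w ≡ w
      alone-before = trans (label-at st (walker w) w<m)
        (cong (λ b → if b then groupLabel (x w) else w) (≤ᵇ-false {suc w} {w} (ℕP.<-irrefl refl)))
      joined-now : label st′ w ≡ groupLabel (x w)
      joined-now = trans (label-at st′ (walker w) w<m)
        (cong (λ b → if b then groupLabel (x w) else w) (≤ᵇ-true (ℕP.≤-refl {w})))
      unchanged : ∀ c → c ≢ walker w → place st′ c ≡ place st c
      unchanged (walker i)   c≢ = cong (λ b → if b then groupLabel (x i) else i)
                                       (≤ᵇ-suc (λ i≡w → c≢ (cong walker i≡w)))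
      unchanged (anchor false j) _ = refl
      unchanged (anchor true  j) _ = refl
      unchanged (idler j)        _ = refl

    anchors-join : ∀ {K} g e a → a + e ≡ m → 1 ≤ a →
                   Reach K (label (anchorStage g a)) → Reach K (label (anchorStage g m))
    anchors-join {K} g zero    a a+0≡m _   R =
      subst (λ z → Reach K (label (anchorStage g z))) (trans (sym (ℕP.+-identityʳ a)) a+0≡m) R
    anchors-join     g (suc e) a a+e≡m 1≤a R =
      anchors-join g e (suc a) (trans (sym (ℕP.+-suc a e)) a+e≡m) (ℕP.m≤n⇒m≤1+n 1≤a)
        (reach-weaken {s = label (anchorStage g (suc a))} (ℕP.n≤1+n _)
          (anchor-joins g a 1≤a (subst (a <_) a+e≡m (ℕP.m<m+n a (s≤s z≤n))) R))

    walkers-join : ∀ {K} w → w ≤ m → 1 < m → x 1 ≡ false →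
                   Reach K (label (stage m m w x)) → Reach K (label (settled x))
    walkers-join zero    _   _   _    R = R
    walkers-join (suc w) w<m 1<m x1≡A R =
      walkers-join w (ℕP.<⇒≤ w<m) 1<m x1≡A
        (reach-weaken {s = label (stage m m w x)} (ℕP.n≤1+n _) (walker-joins w w<m 1<m x1≡A R))

    formation : 1 < m → x 1 ≡ false → Reach 0 (label (settled x))
    formation 1<m x1≡A =
      walkers-join m ℕP.≤-refl 1<m x1≡A
        (anchors-join true (m ∸ 1) 1 (ℕP.m+[n∸m]≡n m≥1) ℕP.≤-refl
          (anchors-join false (m ∸ 1) 1 (ℕP.m+[n∸m]≡n m≥1) ℕP.≤-refl
            (reach-≗ (λ k k<n → sym (initial x k k<n)) reach-start)))

  -- In a settled arrangement, walker i counts the walkers on its side (itself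
  -- included, hence the + 1) and its anchor friends there: i on side A, m − i on side B.
  walkersOn : (ℕ → Bool) → Bool → ℕ
  walkersOn x g = ΣN m (λ k → bit (sameSide (x k) g))

  anchorFriends : Bool → ℕ → ℕ
  anchorFriends false i = i
  anchorFriends true  i = m ∸ i

  sameSide-refl : ∀ g → sameSide g g ≡ true
  sameSide-refl false = refl
  sameSide-refl true  = refl

  groupLabel-≡ᵇ : ∀ a b → (groupLabel a ≡ᵇ groupLabel b) ≡ sameSide a b
  groupLabel-≡ᵇ false false = ≡ᵇ-true {groupLabel false} refl
  groupLabel-≡ᵇ true  true  = ≡ᵇ-true {groupLabel true} refl
  groupLabel-≡ᵇ false true  = ≡ᵇ-false (λ eq → sides (index-injective (anchor false 0) (anchor true 0) m≥1 m≥1 eq))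
    where sides : anchor false 0 ≢ anchor true 0
          sides ()
  groupLabel-≡ᵇ true  false = ≡ᵇ-false (λ eq → sides (index-injective (anchor true 0) (anchor false 0) m≥1 m≥1 eq))
    where sides : anchor true 0 ≢ anchor false 0
          sides ()

  module SettledUtility (x : ℕ → Bool) (i : ℕ) (i<m : i < m) where
    s : ℕ → ℕ
    s = label (settled x)

    s-walker : ∀ k → k < m → s k ≡ groupLabel (x k)
    s-walker k k<m = label-at (settled x) (walker k) k<m

    s-anchor : ∀ g j → j < m → s (index (anchor g j)) ≡ groupLabel g
    s-anchor g j j<m = trans (label-at (settled x) (anchor g j) j<m) (joined-all g)
      where joined-all : ∀ g → place (settled x) (anchor g j) ≡ groupLabel g
            joined-all false = cong (λ b → if b then groupLabel false else m + j) (<ᵇ-true j<m)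
            joined-all true  = cong (λ b → if b then groupLabel true else m + (m + j)) (<ᵇ-true j<m)

    buddy-at : ∀ c → Valid c → index c ≢ i →
               buddy s i (index c) ≡ (if s (index c) ≡ᵇ groupLabel (x i) then bit (friendly (walker i) c) else 0)
    buddy-at c vc c≢i = cong₃ (λ a l b → if not a ∧ (s (index c) ≡ᵇ l) then bit b else 0)
      (≡ᵇ-false c≢i) (s-walker i i<m) (cong₂ friendly (index-block (walker i) i<m) (index-block c vc))

    walker-part : ΣN m (buddy s i) + 1 ≡ walkersOn x (x i)
    walker-part = begin
        ΣN m (buddy s i) + 1
      ≡⟨ cong (ΣN m (buddy s i) +_) (cong bit (sameSide-refl (x i))) ⟨
        ΣN m (buddy s i) + bit (sameSide (x i) (x i))
      ≡⟨ ΣN-update m (λ k → bit (sameSide (x k) (x i))) (buddy s i) i i<m same-side ⟩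
        walkersOn x (x i) + buddy s i i
      ≡⟨ cong (walkersOn x (x i) +_) self ⟩
        walkersOn x (x i) + 0
      ≡⟨ ℕP.+-identityʳ _ ⟩
        walkersOn x (x i) ∎
      where
      open ≡-Reasoning
      self : buddy s i i ≡ 0
      self = cong (λ a → if not a ∧ (s i ≡ᵇ s i) then bit (friendly (block i) (block i)) else 0) (≡ᵇ-true {i} refl)
      same-side : ∀ k → k < m → k ≢ i → buddy s i k ≡ bit (sameSide (x k) (x i))
      same-side k k<m k≢i = trans (buddy-at (walker k) k<m k≢i)
        (cong (λ b → if b then 1 else 0) (trans (cong (_≡ᵇ groupLabel (x i)) (s-walker k k<m)) (groupLabel-≡ᵇ (x k) (x i))))

    anchor-part : ∀ g → ΣN m (λ j → buddy s i (index (anchor g j))) ≡ (if sameSide g (x i) then anchorFriends g i else 0)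
    anchor-part g = trans (ΣN-cong m pointwise) (by-side (sameSide g (x i)))
      where
      pointwise : ∀ j → j < m → buddy s i (index (anchor g j)) ≡
                  (if sameSide g (x i) then bit (friendly (walker i) (anchor g j)) else 0)
      pointwise j j<m = trans
        (buddy-at (anchor g j) j<m (λ eq → walker≢anchor (index-injective (walker i) (anchor g j) i<m j<m (sym eq))))
        (cong (λ b → if b then bit (friendly (walker i) (anchor g j)) else 0)
              (trans (cong (_≡ᵇ groupLabel (x i)) (s-anchor g j j<m)) (groupLabel-≡ᵇ g (x i))))
        where walker≢anchor : walker i ≢ anchor g j
              walker≢anchor ()
      counted : ∀ g → ΣN m (λ j → bit (friendly (walker i) (anchor g j))) ≡ anchorFriends g i
      counted false = count-below m i (ℕP.<⇒≤ i<m)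
      counted true  = count-from m i (ℕP.<⇒≤ i<m)
      by-side : ∀ b → ΣN m (λ j → if b then bit (friendly (walker i) (anchor g j)) else 0) ≡
                      (if b then anchorFriends g i else 0)
      by-side true  = counted g
      by-side false = ΣN-zero m _ (λ _ _ → refl)

    idler-part : ΣN d (λ j → buddy s i (index (idler j))) ≡ 0
    idler-part = ΣN-zero d _ λ j j<d → trans
      (cong (λ c → if together j then bit (friendly (block i) c) else 0) (index-block (idler j) j<d))
      (nothing (together j) (friendly (block i) (idler j)) (no-idler-friends (block i) j))
      where
      together : ℕ → Bool
      together j = not (index (idler j) ≡ᵇ i) ∧ (s (index (idler j)) ≡ᵇ s i)
      nothing : ∀ c f → f ≡ false → (if c then bit f else 0) ≡ 0
      nothing true  _ refl = refl
      nothing false _ _    = refl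
      no-idler-friends : ∀ b j → friendly b (idler j) ≡ false
      no-idler-friends (walker _)       _ = refl
      no-idler-friends (anchor false _) _ = refl
      no-idler-friends (anchor true  _) _ = refl
      no-idler-friends (idler _)        _ = refl

    walker-utility : U s i + 1 ≡ walkersOn x (x i) + anchorFriends (x i) i
    walker-utility = begin
        U s i + 1
      ≡⟨ cong (_+ 1) (trans (ΣN-split m (m + (m + d)) _)
           (cong (ΣN m (buddy s i) +_) (trans (ΣN-split m (m + d) _)
             (cong (ΣN m (λ j → buddy s i (m + j)) +_) (ΣN-split m d _))))) ⟩
        ΣN m (buddy s i) + (A + (B + I)) + 1
      ≡⟨ cong (λ z → ΣN m (buddy s i) + (A + (B + z)) + 1) idler-part ⟩
        ΣN m (buddy s i) + (A + (B + 0)) + 1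
      ≡⟨ regroup (ΣN m (buddy s i)) A B ⟩
        (ΣN m (buddy s i) + 1) + (A + B)
      ≡⟨ cong₂ _+_ walker-part (cong₂ _+_ (anchor-part false) (anchor-part true) ⟨ trans ⟩ on-side (x i)) ⟩
        walkersOn x (x i) + anchorFriends (x i) i ∎
      where
      open ≡-Reasoning
      A B I : ℕ
      A = ΣN m (λ j → buddy s i (index (anchor false j)))
      B = ΣN m (λ j → buddy s i (index (anchor true j)))
      I = ΣN d (λ j → buddy s i (index (idler j)))
      regroup : ∀ w a b → w + (a + (b + 0)) + 1 ≡ (w + 1) + (a + b)
      regroup = solve-∀
      on-side : ∀ g → (if sameSide false g then anchorFriends false i else 0) +
                      (if sameSide true g then anchorFriends true i else 0) ≡ anchorFriends g i
      on-side false = ℕP.+-identityʳ i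
      on-side true  = refl

  open SettledUtility using (walker-utility)

  walkersOn-total : ∀ x → walkersOn x false + walkersOn x true ≡ m
  walkersOn-total x = trans (sym (ΣN-+ m _ _)) (ΣN-ones m _ (λ k _ → one-side (x k)))
    where one-side : ∀ b → bit (sameSide b false) + bit (sameSide b true) ≡ 1
          one-side false = refl
          one-side true  = refl

  walkersOn-flip : ∀ x x′ j → j < m → x′ j ≡ not (x j) → (∀ i → i ≢ j → x′ i ≡ x i) →
                   walkersOn x′ (x′ j) ≡ walkersOn x (x′ j) + 1
  walkersOn-flip x x′ j j<m flipped agree = begin
      walkersOn x′ (x′ j)
    ≡⟨ ℕP.+-identityʳ _ ⟨
      walkersOn x′ (x′ j) + 0
    ≡⟨ cong (walkersOn x′ (x′ j) +_) gone ⟨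
      walkersOn x′ (x′ j) + bit (sameSide (x j) (x′ j))
    ≡⟨ ΣN-update m _ _ j j<m (λ k _ k≢j → cong (λ b → bit (sameSide b (x′ j))) (agree k k≢j)) ⟩
      walkersOn x (x′ j) + bit (sameSide (x′ j) (x′ j))
    ≡⟨ cong (λ b → walkersOn x (x′ j) + bit b) (sameSide-refl (x′ j)) ⟩
      walkersOn x (x′ j) + 1 ∎
    where
    open ≡-Reasoning
    other-side : ∀ b → bit (sameSide b (not b)) ≡ 0
    other-side false = refl
    other-side true  = refl
    gone : bit (sameSide (x j) (x′ j)) ≡ 0
    gone = trans (cong (λ b → bit (sameSide (x j) b)) flipped) (other-side (x j))

  walkersOn-join : ∀ x x′ j → j < m → x j ≡ false → x′ j ≡ true → (∀ i → i ≢ j → x′ i ≡ x i) →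
                   walkersOn x′ true ≡ walkersOn x true + 1
  walkersOn-join x x′ j j<m xj x′j agree = subst (λ b → walkersOn x′ b ≡ walkersOn x b + 1) x′j
    (walkersOn-flip x x′ j j<m (trans x′j (cong not (sym xj))) agree)

  walkersOn-leave : ∀ x x′ i → i < m → x i ≡ true → x′ i ≡ false → (∀ k → k ≢ i → x′ k ≡ x k) →
                    walkersOn x true ≡ walkersOn x′ true + 1
  walkersOn-leave x x′ i i<m xi x′i agree = subst (λ b → walkersOn x b ≡ walkersOn x′ b + 1) xi
    (walkersOn-flip x′ x i i<m (trans xi (cong not (sym x′i))) (λ k k≢i → sym (agree k k≢i)))

  from-m−1-to-m : ∀ {a b} → a + 1 ≡ m → b + 1 ≡ suc m → a < b
  from-m−1-to-m {a} {b} a+1≡m b+1≡1+m = ℕP.≤-reflexive (trans (sym (ℕP.+-comm a 1))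
    (trans a+1≡m (sym (ℕP.suc-injective (trans (sym (ℕP.+-comm b 1)) b+1≡1+m)))))

  switch : ∀ {K} x x′ j → j < m → (∀ i → i ≢ j → x′ i ≡ x i) →
           walkersOn x (x j) + anchorFriends (x j) j ≡ m →
           walkersOn x′ (x′ j) + anchorFriends (x′ j) j ≡ suc m →
           Reach K (label (settled x)) → Reach (suc K) (label (settled x′))
  switch x x′ j j<m agree before after = reach-move j (index<n (walker j) j<m)
    (λ k _ k≢j → label-agree (settled x) (settled x′) (walker j) unchanged k k≢j)
    (from-m−1-to-m (trans (walker-utility x j j<m) before) (trans (walker-utility x′ j j<m) after))
    where
    unchanged : ∀ c → c ≢ walker j → place (settled x′) c ≡ place (settled x) c
    unchanged (walker i)       c≢ = cong groupLabel (agree i (λ i≡j → c≢ (cong walker i≡j)))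
    unchanged (anchor false _) _  = refl
    unchanged (anchor true  _) _  = refl
    unchanged (idler _)        _  = refl

  join-B : ∀ {K} x x′ j → j < m → x j ≡ false → x′ j ≡ true → (∀ i → i ≢ j → x′ i ≡ x i) →
           walkersOn x true ≡ j → Reach K (label (settled x)) → Reach (suc K) (label (settled x′))
  join-B x x′ j j<m xj x′j agree onB = switch x x′ j j<m agree
    (subst (λ b → walkersOn x b + anchorFriends b j ≡ m) (sym xj)
           (trans (cong (walkersOn x false +_) (sym onB)) (walkersOn-total x)))
    (subst (λ b → walkersOn x′ b + anchorFriends b j ≡ suc m) (sym x′j) (begin
        walkersOn x′ true + (m ∸ j)
      ≡⟨ cong (_+ (m ∸ j)) (walkersOn-join x x′ j j<m xj x′j agree) ⟩
        walkersOn x true + 1 + (m ∸ j)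
      ≡⟨ cong (λ c → c + 1 + (m ∸ j)) onB ⟩
        j + 1 + (m ∸ j)
      ≡⟨ cong (_+ (m ∸ j)) (ℕP.+-comm j 1) ⟩
        suc (j + (m ∸ j))
      ≡⟨ cong suc (ℕP.m+[n∸m]≡n (ℕP.<⇒≤ j<m)) ⟩
        suc m ∎))
    where open ≡-Reasoning

  leave-B : ∀ {K} x x′ i → i < m → x i ≡ true → x′ i ≡ false → (∀ k → k ≢ i → x′ k ≡ x k) →
            walkersOn x true ≡ i → Reach K (label (settled x)) → Reach (suc K) (label (settled x′))
  leave-B x x′ i i<m xi x′i agree onB = switch x x′ i i<m agree
    (subst (λ b → walkersOn x b + anchorFriends b i ≡ m) (sym xi)
           (trans (cong (_+ (m ∸ i)) onB) (ℕP.m+[n∸m]≡n (ℕP.<⇒≤ i<m))))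
    (subst (λ b → walkersOn x′ b + anchorFriends b i ≡ suc m) (sym x′i) (begin
        walkersOn x′ false + i
      ≡⟨ cong (_+ i) (subst (λ b → walkersOn x′ b ≡ walkersOn x b + 1) x′i
                             (walkersOn-flip x x′ i i<m (trans x′i (cong not (sym xi))) agree)) ⟩
        walkersOn x false + 1 + i
      ≡⟨ cong (λ c → walkersOn x false + 1 + c) onB ⟨
        walkersOn x false + 1 + walkersOn x true
      ≡⟨ regroup (walkersOn x false) (walkersOn x true) ⟩
        suc (walkersOn x false + walkersOn x true)
      ≡⟨ cong suc (walkersOn-total x) ⟩
        suc m ∎))
    where
    open ≡-Reasoning
    regroup : ∀ a b → a + 1 + b ≡ suc (a + b)
    regroup = solve-∀

  onB : ℕ → ℕ → ℕ → ℕ → Bool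
  onB lo len t k = ((lo ≤ᵇ k) ∧ (k <ᵇ lo + len)) ∨ (t ≤ᵇ k)

  onB-new : ∀ lo len t → onB lo (suc len) t (lo + len) ≡ true
  onB-new lo len t rewrite ≤ᵇ-true (ℕP.m≤m+n lo len)
                         | <ᵇ-true (subst (lo + len <_) (sym (ℕP.+-suc lo len)) (ℕP.n<1+n (lo + len))) = refl

  onB-old : ∀ lo len t → lo + len < t → onB lo len t (lo + len) ≡ false
  onB-old lo len t j<t rewrite <ᵇ-false {lo + len} {lo + len} (ℕP.<-irrefl refl)
                             | BoolP.∧-zeroʳ (lo ≤ᵇ lo + len) | ≤ᵇ-false (ℕP.<⇒≱ j<t) = refl

  onB-agree : ∀ lo len t k → k ≢ lo + len → onB lo (suc len) t k ≡ onB lo len t k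
  onB-agree lo len t k k≢j = cong (λ b → ((lo ≤ᵇ k) ∧ b) ∨ (t ≤ᵇ k))
    (trans (cong (k <ᵇ_) (ℕP.+-suc lo len)) (<ᵇ-suc k≢j))

  onB-none : ∀ lo t k → onB lo 0 t k ≡ (t ≤ᵇ k)
  onB-none lo t k with k ℕ.<? lo
  ... | yes k<lo = cong (λ b → (b ∧ (k <ᵇ lo + 0)) ∨ (t ≤ᵇ k)) (≤ᵇ-false (ℕP.<⇒≱ k<lo))
  ... | no  k≮lo = cong (λ b → ((lo ≤ᵇ k) ∧ b) ∨ (t ≤ᵇ k))
                        (<ᵇ-false (subst (λ z → ¬ k < z) (sym (ℕP.+-identityʳ lo)) k≮lo))
                   ⟨ trans ⟩ cong (_∨ (t ≤ᵇ k)) (BoolP.∧-zeroʳ (lo ≤ᵇ k))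

  onB-upto : ∀ lo len t k → lo + len ≡ t → onB lo len t k ≡ (lo ≤ᵇ k)
  onB-upto lo len t k touch with k ℕ.<? t
  ... | yes k<t = cong₂ (λ a b → ((lo ≤ᵇ k) ∧ a) ∨ b) (<ᵇ-true (subst (k <_) (sym touch) k<t)) (≤ᵇ-false (ℕP.<⇒≱ k<t))
                  ⟨ trans ⟩ trans (BoolP.∨-identityʳ _) (BoolP.∧-identityʳ _)
  ... | no  k≮t = cong (((lo ≤ᵇ k) ∧ (k <ᵇ lo + len)) ∨_) (≤ᵇ-true (ℕP.≮⇒≥ k≮t))
                  ⟨ trans ⟩ trans (BoolP.∨-zeroʳ _)
                                  (sym (≤ᵇ-true (ℕP.≤-trans (subst (lo ≤_) touch (ℕP.m≤m+n lo len)) (ℕP.≮⇒≥ k≮t))))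

  walkersOn-from : ∀ t → t ≤ m → walkersOn (t ≤ᵇ_) true ≡ m ∸ t
  walkersOn-from t t≤m = trans (ΣN-cong m (λ k _ → cong bit (sameSide-true (t ≤ᵇ k)))) (count-from m t t≤m)
    where sameSide-true : ∀ b → sameSide b true ≡ b
          sameSide-true false = refl
          sameSide-true true  = refl

  Settled : ℕ → (ℕ → Bool) → Set
  Settled K x = Reach K (label (settled x))

  settled-≗ : ∀ {K x y} → (∀ k → x k ≡ y k) → Settled K x → Settled K y
  settled-≗ {x = x} {y} x≗y = reach-≗ (λ k _ → same (block k))
    where same : ∀ b → place (settled x) b ≡ place (settled y) b
          same (walker i)       = cong groupLabel (x≗y i)
          same (anchor false _) = refl
          same (anchor true  _) = refl
          same (idler _)        = refl

  join-sweep : ∀ {K} lo t e len → lo + len + e ≡ t → t ≤ m → walkersOn (onB lo len t) true ≡ lo + len →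
               Settled K (onB lo len t) → Settled (e + K) (onB lo (len + e) t)
  join-sweep {K} lo t zero len _ _ _ R = subst (λ z → Settled K (onB lo z t)) (sym (ℕP.+-identityʳ len)) R
  join-sweep {K} lo t (suc e) len filled t≤m count R =
    reach-weaken {s = label (settled (onB lo (len + suc e) t))} (ℕP.≤-reflexive (sym (ℕP.+-suc e K)))
      (subst (λ z → Settled (e + suc K) (onB lo z t)) (sym (ℕP.+-suc len e))
        (join-sweep lo t e (suc len) (trans (cong (_+ e) (ℕP.+-suc lo len)) (trans (sym (ℕP.+-suc (lo + len) e)) filled))
                    t≤m count′
          (join-B x x′ j (ℕP.<-≤-trans j<t t≤m) (onB-old lo len t j<t) (onB-new lo len t)
                  (λ k k≢j → onB-agree lo len t k k≢j) count R)))
    where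
    x x′ : ℕ → Bool
    x  = onB lo len t
    x′ = onB lo (suc len) t
    j : ℕ
    j = lo + len
    j<t : j < t
    j<t = subst (j <_) filled (ℕP.m<m+n j (s≤s z≤n))
    count′ : walkersOn x′ true ≡ lo + suc len
    count′ = trans (walkersOn-join x x′ j (ℕP.<-≤-trans j<t t≤m) (onB-old lo len t j<t) (onB-new lo len t)
                                   (λ k k≢j → onB-agree lo len t k k≢j))
                   (trans (cong (_+ 1) count) (trans (ℕP.+-comm j 1) (sym (ℕP.+-suc lo len))))

  leave-sweep : ∀ {K} lo t len → suc lo + len ≤ t → t ≤ m → walkersOn (onB (suc lo) len t) true ≡ lo + len →
                Settled K (onB (suc lo) len t) → Settled (len + K) (onB (suc lo) 0 t)
  leave-sweep lo t zero    _   _   _     R = R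
  leave-sweep {K} lo t (suc l) fits t≤m count R =
    reach-weaken {s = label (settled (onB (suc lo) 0 t))} (ℕP.≤-reflexive (sym (ℕP.+-suc l K)))
      (leave-sweep lo t l (ℕP.<⇒≤ (subst (_≤ t) (ℕP.+-suc (suc lo) l) fits)) t≤m count′
        (leave-B x x′ i i<m (onB-new (suc lo) l t) (onB-old (suc lo) l t i<t)
                 (λ k k≢i → sym (onB-agree (suc lo) l t k k≢i)) (trans count (ℕP.+-suc lo l)) R))
    where
    x x′ : ℕ → Bool
    x  = onB (suc lo) (suc l) t
    x′ = onB (suc lo) l t
    i : ℕ
    i = suc lo + l
    i<t : i < t
    i<t = subst (_≤ t) (ℕP.+-suc (suc lo) l) fits
    i<m : i < m
    i<m = ℕP.<-≤-trans i<t t≤m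
    count′ : walkersOn x′ true ≡ lo + l
    count′ = ℕP.suc-injective (trans (ℕP.+-comm 1 _) (trans (sym
      (walkersOn-leave x x′ i i<m (onB-new (suc lo) l t) (onB-old (suc lo) l t i<t)
                       (λ k k≢i → sym (onB-agree (suc lo) l t k k≢i))))
      (trans count (ℕP.+-suc lo l))))

  walkersOn-≗ : ∀ {x y} → (∀ k → x k ≡ y k) → ∀ g → walkersOn x g ≡ walkersOn y g
  walkersOn-≗ x≗y g = ΣN-cong m (λ k _ → cong (λ b → bit (sameSide b g)) (x≗y k))

  sideFrom : ℕ → ℕ → Bool
  sideFrom t k = t ≤ᵇ k

  -- Phase r + 1, starting with the top r + 1 walkers on side B: walkers
  -- r + 1, …, m − r − 2 join B, then walkers m − r − 1, …, r + 1 leave it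
  -- again, which leaves the top r walkers on side B.
  phase : ∀ {K} r → suc r + suc r ≤ m → Settled K (sideFrom (m ∸ suc r)) →
          Settled ((m ∸ suc r ∸ suc r) + K) (sideFrom (m ∸ r))
  phase {K} r fits R =
    settled-≗ (λ k → trans (onB-none s (suc t) k) (cong (_≤ᵇ k) t+1≡m∸r))
      (reach-weaken {s = label (settled (onB s 0 (suc t)))} (ℕP.m≤n+m (u + K) (suc u))
        (leave-sweep r (suc t) (suc u) (ℕP.≤-reflexive (trans (ℕP.+-suc s u) (cong suc s+u≡t)))
                     (subst (_≤ m) (sym t+1≡m∸r) (ℕP.m∸n≤m m r)) count-before-leaving
          (settled-≗ (λ k → trans (onB-upto s u t k s+u≡t)
                                  (sym (onB-upto s (suc u) (suc t) k (trans (ℕP.+-suc s u) (cong suc s+u≡t)))))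
            (join-sweep s t u 0 (cong (_+ u) (ℕP.+-identityʳ s) ⟨ trans ⟩ s+u≡t) (ℕP.m∸n≤m m s) count-at-start
              (settled-≗ (λ k → sym (onB-none s t k)) R)))))
    where
    s t u : ℕ
    s = suc r
    t = m ∸ s
    u = t ∸ s
    s≤m : s ≤ m
    s≤m = ℕP.m+n≤o⇒m≤o s fits
    s≤t : s ≤ t
    s≤t = ℕP.m+n≤o⇒m≤o∸n s fits
    s+u≡t : s + u ≡ t
    s+u≡t = ℕP.m+[n∸m]≡n s≤t
    t+1≡m∸r : suc t ≡ m ∸ r
    t+1≡m∸r = sym (ℕP.+-∸-assoc 1 s≤m)
    count-at-start : walkersOn (onB s 0 t) true ≡ s + 0
    count-at-start = trans (walkersOn-≗ (onB-none s t) true)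
      (trans (walkersOn-from t (ℕP.m∸n≤m m s)) (trans (ℕP.m∸[m∸n]≡n s≤m) (sym (ℕP.+-identityʳ s))))
    count-before-leaving : walkersOn (onB s (suc u) (suc t)) true ≡ r + suc u
    count-before-leaving = trans
      (walkersOn-≗ (λ k → onB-upto s (suc u) (suc t) k (trans (ℕP.+-suc s u) (cong suc s+u≡t))) true)
      (trans (walkersOn-from s s≤m) (sym (trans (ℕP.+-suc r u) s+u≡t)))

  phases : ∀ {K} q → q + q ≤ m → Settled K (sideFrom (m ∸ q)) → Settled (q * (m ∸ q ∸ q) + K) (sideFrom m)
  phases zero _ R = R
  phases {K} (suc r) fits R =
    reach-weaken {s = label (settled (sideFrom m))} more-phases
      (phases r (ℕP.≤-trans (ℕP.+-mono-≤ (ℕP.n≤1+n r) (ℕP.n≤1+n r)) fits) (phase r fits R))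
    where
    shorter : m ∸ suc r ∸ suc r ≤ m ∸ r ∸ r
    shorter = ℕP.∸-mono (ℕP.∸-monoʳ-≤ m (ℕP.n≤1+n r)) (ℕP.n≤1+n r)
    more-phases : suc r * (m ∸ suc r ∸ suc r) + K ≤ r * (m ∸ r ∸ r) + ((m ∸ suc r ∸ suc r) + K)
    more-phases = subst (_≤ r * (m ∸ r ∸ r) + ((m ∸ suc r ∸ suc r) + K))
      (regroup r (m ∸ suc r ∸ suc r) K)
      (ℕP.+-monoˡ-≤ ((m ∸ suc r ∸ suc r) + K) (ℕP.*-monoʳ-≤ r shorter))
      where regroup : ∀ r u K → r * u + (u + K) ≡ suc r * u + K
            regroup = solve-∀

  quadratic-run : ∀ q → q + q ≤ m → 2 ≤ m ∸ q →
                  Σ ℕ λ L → Σ (Coloring n) λ c → Run game 2 L c × q * (m ∸ q ∸ q) ≤ L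
  quadratic-run q fits two
    with phases q fits (Formation.formation (sideFrom (m ∸ q)) 1<m (≤ᵇ-false (ℕP.<⇒≱ two)))
    where 1<m = ℕP.≤-trans two (ℕP.m∸n≤m m q)
  ... | L , long , c , run , _ = L , c , run , ℕP.≤-trans (ℕP.m≤m+n _ 0) long

-- For n ≥ 12 write n = 12q + r (r < 12) and use m = 4q walkers and r idlers:
-- phases q, …, 1 make at least q · 2q = 2q² deviations, and n ≤ 23q.
module LowerBound where
  open import Data.Nat using (ℕ; _+_; _*_; _∸_; _≤_)
  import Data.Nat.Properties as ℕP
  open import Data.Nat.DivMod using (_/_; _%_; m≡m%n+[m/n]*n; m%n<n; m≥n⇒m/n>0)
  open import Data.Nat.Tactic.RingSolver using (solve-∀)
  open import Data.Product using (Σ; _×_; _,_)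
  open import Relation.Binary.PropositionalEquality

  long-runs : ∀ n → 12 ≤ n → Σ (Game n) λ G → AllowedGame G ×
              (Σ ℕ λ L → Σ (Coloring n) λ c → Run G 2 L c × n * n ≤ 265 * L)
  long-runs n 12≤n = subst (λ k → Σ (Game k) λ G → AllowedGame G ×
                                  (Σ ℕ λ L → Σ (Coloring k) λ c → Run G 2 L c × k * k ≤ 265 * L))
                           (sym n≡12q+r) (finish (quadratic-run q q+q≤m 2≤m∸q))
    where
    q r m : ℕ
    q = n / 12
    r = n % 12
    m = q + (q + (q + q))
    1≤q : 1 ≤ q
    1≤q = m≥n⇒m/n>0 12≤n
    open Construction m r (ℕP.≤-trans 1≤q (ℕP.m≤m+n q _)) using (game; allowed; quadratic-run)
    n≡12q+r : n ≡ m + (m + (m + r))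
    n≡12q+r = trans (m≡m%n+[m/n]*n n 12) (split q r)
      where split : ∀ q r → r + q * 12 ≡ (q + (q + (q + q))) + ((q + (q + (q + q))) + ((q + (q + (q + q))) + r))
            split = solve-∀
    m∸q≡3q : m ∸ q ≡ q + (q + q)
    m∸q≡3q = ℕP.m+n∸m≡n q (q + (q + q))
    q+q≤m : q + q ≤ m
    q+q≤m = ℕP.+-monoʳ-≤ q (ℕP.m≤m+n q _)
    2≤m∸q : 2 ≤ m ∸ q
    2≤m∸q = subst (2 ≤_) (sym m∸q≡3q) (ℕP.+-mono-≤ 1≤q (ℕP.≤-trans 1≤q (ℕP.m≤m+n q q)))
    n≤23q : m + (m + (m + r)) ≤ 23 * q
    n≤23q = subst (_≤ 23 * q) (trans (sym (m≡m%n+[m/n]*n n 12)) n≡12q+r)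
      (subst (r + q * 12 ≤_) (twenty-three q)
             (ℕP.+-monoˡ-≤ (q * 12) (ℕP.≤-trans (ℕP.≤-pred (m%n<n n 12)) (ℕP.*-monoʳ-≤ 11 1≤q))))
      where twenty-three : ∀ q → 11 * q + q * 12 ≡ 23 * q
            twenty-three = solve-∀
    N : ℕ
    N = m + (m + (m + r))
    finish : (Σ ℕ λ L → Σ (Coloring N) λ c → Run game 2 L c × q * (m ∸ q ∸ q) ≤ L) →
             Σ (Game N) λ G → AllowedGame G × (Σ ℕ λ L → Σ (Coloring N) λ c → Run G 2 L c × N * N ≤ 265 * L)
    finish (L , c , run , long) = game , allowed , L , c , run , (begin
        N * N                   ≤⟨ ℕP.*-mono-≤ n≤23q n≤23q ⟩
        23 * q * (23 * q)       ≡⟨ squares q ⟩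
        529 * (q * q)           ≤⟨ ℕP.*-monoˡ-≤ (q * q) (ℕP.n≤1+n 529) ⟩
        530 * (q * q)           ≡⟨ doubling q ⟩
        265 * (q * (q + q))     ≡⟨ cong (λ z → 265 * (q * z)) m∸q∸q≡2q ⟨
        265 * (q * (m ∸ q ∸ q)) ≤⟨ ℕP.*-monoʳ-≤ 265 long ⟩
        265 * L                 ∎)
      where
      open ℕP.≤-Reasoning
      squares : ∀ q → 23 * q * (23 * q) ≡ 529 * (q * q)
      squares = solve-∀
      doubling : ∀ q → 530 * (q * q) ≡ 265 * (q * (q + q))
      doubling = solve-∀
      m∸q∸q≡2q : m ∸ q ∸ q ≡ q + q
      m∸q∸q≡2q = trans (cong (_∸ q) m∸q≡3q) (ℕP.m+n∸m≡n q (q + q))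

open import Data.Nat using (ℕ; _≤_; _*_; _+_; suc)
open import Data.Product using (Σ; _×_; _,_)

lemma2 : (Σ ℕ λ C → ∀ n (G : Game n) → AllowedGame G →
    ∀ L c → Run G 2 L c → L ≤ C * (n * n) + C)
    × (Σ ℕ λ d → Σ ℕ λ N → ∀ n → N ≤ n →
    Σ (Game n) λ G → AllowedGame G × (Σ ℕ λ L → Σ (Coloring n) λ c →
    Run G 2 L c × n * n ≤ suc d * L))
lemma2 = (1 , upper) , (264 , 12 , LowerBound.long-runs)
  where
  open import Data.Nat.Properties using (≤-trans; ≤-reflexive; *-identityˡ; m≤m+n)
  open import Relation.Binary.PropositionalEquality using (sym)
  upper : ∀ n (G : Game n) → AllowedGame G → ∀ L c → Run G 2 L c → L ≤ 1 * (n * n) + 1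
  upper n G allowed L c run =
    ≤-trans (Potential.run-length G allowed run) (≤-trans (≤-reflexive (sym (*-identityˡ (n * n)))) (m≤m+n _ 1))
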